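{- The rank reduction problem can be solved in polynomial time on partition matroids; that is, there is a polynomial-time algorithm which, given a model $((E_1,d_1),\dots,(E_p,d_p))$ of a partition matroid $M$ with ground set $E=E_1\cup\cdots\cup E_p$ and rank function $r$, together with a positive integer $k$, outputs a minimum-size set $X\subseteq E$ such that $r(E\setminus X)\le r(E)-k$.
   Context: A partition matroid is given by a model $((E_1,d_1),\dots,(E_p,d_p))$, where $E_1,\dots,E_p$ are pairwise disjoint finite sets and $d_1,\dots,d_p$ are integers with $0\le d_i\le |E_i|$ for each $i\in\{1,\dots,p\}$. Its ground set is $E=E_1\cup\cdots\cup E_p$, and $X\subseteq E$ is independent iff $|E_i\cap X|\le d_i$ for every $i\in\{1,\dots,p\}$. The rank $r(X)$ of $X\subseteq E$ is the maximum size of an independent set contained in $X$. The rank reduction problem: given a matroid on ground set $E$ with rank function $r$ and a positive integer $k$, find a minimum-size subset $X\subseteq E$ with $r(E\setminus X)\le r(E)-k$. The matroid is given as input via its model (not as an explicit set system), and the input size is measured accordingly. -}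

module Defs where

open import Data.Fin using (Fin; zero)
open import Data.Integer as ℤ using (+_)
open import Data.List using (List; []; _∷_; _++_; map; length; filter; concatMap)
open import Data.List.Extrema.Nat using (max)
open import Data.List.Relation.Binary.Disjoint.Propositional using (Disjoint)
open import Data.List.Relation.Binary.Subset.Propositional using (_⊆_)
open import Data.List.Relation.Unary.All using (All; all?)
open import Data.List.Relation.Unary.AllPairs using (AllPairs)
open import Data.List.Relation.Unary.Unique.Propositional using (Unique)
open import Data.Maybe using (Maybe; just; nothing)
open import Data.Nat using (ℕ; zero; suc; _+_; _*_; _^_; _≤_; _<_; _≤?_; _≟_)
open import Data.Nat.Binary using (ℕᵇ; 2[1+_]; 1+[2_]; fromℕ)
import Data.Nat.Binary as ℕᵇ
open import Data.Product using (Σ-syntax; ∃-syntax; _×_; _,_)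
open import Data.Vec using (Vec; _∷_; lookup; replicate; _[_]≔_)
open import Relation.Binary.PropositionalEquality using (_≡_; _≢_)
open import Relation.Nullary using (¬_; Dec; _×-dec_; ¬?)

open import Data.List.Membership.DecPropositional _≟_ using (_∈?_)
open import Data.List.Relation.Binary.Subset.DecPropositional _≟_ using (_⊆?_)

------------------------------------------------------------------------
-- Machine model: the WHILE language over binary trees of N. D. Jones,
-- "Computability and Complexity from a Programming Perspective" (1997).
-- All control flow and all data manipulation is by the program itself,
-- one time unit per elementary operation on a tree.  Unit cost is
-- realistic because trees can be kept in memory as shared (DAG)
-- structures, of which each operation allocates at most one cell; the
-- polynomial-time decision problems are those of Turing machines.

infixr 5 _∙_

data Tree : Set where
  nil : Tree
  _∙_ : Tree → Tree → Tree

size : Tree → ℕ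
size nil     = 1
size (l ∙ r) = suc (size l + size r)

head tail : Tree → Tree
head nil     = nil
head (l ∙ r) = l
tail nil     = nil
tail (l ∙ r) = r

data Expr (n : ℕ) : Set where
  var   : Fin n → Expr n
  nil   : Expr n
  cons  : Expr n → Expr n → Expr n
  hd tl : Expr n → Expr n

infix  4 _≔_
infixr 3 _⨾_

data Cmd (n : ℕ) : Set where
  skip         : Cmd n
  _≔_          : Fin n → Expr n → Cmd n
  _⨾_          : Cmd n → Cmd n → Cmd n
  if_then_else : Expr n → Cmd n → Cmd n → Cmd n
  while        : Expr n → Cmd n → Cmd n

Store : ℕ → Set
Store n = Vec Tree n

eval : ∀ {n} → Expr n → Store n → Tree
eval (var x)    σ = lookup σ x
eval nil        σ = nil
eval (cons d e) σ = eval d σ ∙ eval e σ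
eval (hd e)     σ = head (eval e σ)
eval (tl e)     σ = tail (eval e σ)

cost : ∀ {n} → Expr n → ℕ
cost (var x)    = 1
cost nil        = 1
cost (cons d e) = suc (cost d + cost e)
cost (hd e)     = suc (cost e)
cost (tl e)     = suc (cost e)

-- Run c σ τ t: started in store σ, command c halts in store τ after t
-- time units.  The tree nil is read as false, all other trees as true.
data Run {n : ℕ} : Cmd n → Store n → Store n → ℕ → Set where
  run-skip   : ∀ {σ} → Run skip σ σ 1
  run-assign : ∀ {x e σ} → Run (x ≔ e) σ (σ [ x ]≔ eval e σ) (suc (cost e))
  run-seq    : ∀ {c d σ τ υ s t} →
               Run c σ τ s → Run d τ υ t → Run (c ⨾ d) σ υ (s + t)
  run-then   : ∀ {e c d σ τ t} → eval e σ ≢ nil →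
               Run c σ τ t → Run (if_then_else e c d) σ τ (suc (cost e + t))
  run-else   : ∀ {e c d σ τ t} → eval e σ ≡ nil →
               Run d σ τ t → Run (if_then_else e c d) σ τ (suc (cost e + t))
  run-stop   : ∀ {e c σ} → eval e σ ≡ nil →
               Run (while e c) σ σ (suc (cost e))
  run-loop   : ∀ {e c σ τ υ s t} → eval e σ ≢ nil →
               Run c σ τ s → Run (while e c) τ υ t →
               Run (while e c) σ υ (suc (cost e + (s + t)))

-- Variable 0 holds the input at the start and the output at the end; all
-- other variables are initially nil.
record Program : Set where
  field
    {extra} : ℕ
    body    : Cmd (suc extra)

Computes : Program → Tree → Tree → ℕ → Set
Computes P input output t =
  ∃[ τ ] Run body (input ∷ replicate extra nil) τ t × lookup τ zero ≡ output
  where open Program P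

-- The size of the output is charged in addition to the running time: with
-- sharing, t steps could otherwise build a tree of size exponential in t.
PolyTimeSolvable : {A B : Set} → (A → Tree) → (B → Tree) → (A → B → Set) → Set
PolyTimeSolvable {A} {B} encodeIn encodeOut Solution =
  Σ[ P ∈ Program ] ∃[ c ] ∃[ d ] ((a : A) →
    Σ[ b ∈ B ] Solution a b ×
    ∃[ t ] Computes P (encodeIn a) (encodeOut b) t ×
           t + size (encodeOut b) ≤ c * size (encodeIn a) ^ d + c)

------------------------------------------------------------------------
-- Partition matroids.  Elements are named by natural numbers, and finite
-- sets are lists of names without repetition.

record Block : Set where
  field
    elements          : List ℕ
    elements-unique   : Unique elements
    capacity          : ℕ
    capacity≤elements : capacity ≤ length elements

open Block public

record Model : Set where
  field
    blocks          : List Block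
    blocks-disjoint : AllPairs (λ B C → Disjoint (elements B) (elements C)) blocks

open Model public

ground : Model → List ℕ
ground M = concatMap elements (blocks M)

∣_∩_∣ : List ℕ → List ℕ → ℕ
∣ X ∩ Y ∣ = length (filter (_∈? Y) X)

infixl 6 _∖_

_∖_ : List ℕ → List ℕ → List ℕ
X ∖ Y = filter (λ x → ¬? (x ∈? Y)) X

Independent : Model → List ℕ → Set
Independent M X =
  X ⊆ ground M × All (λ B → ∣ elements B ∩ X ∣ ≤ capacity B) (blocks M)

independent? : ∀ M X → Dec (Independent M X)
independent? M X =
  (X ⊆? ground M) ×-dec all? (λ B → ∣ elements B ∩ X ∣ ≤? capacity B) (blocks M)

-- The 2 ^ length X subsequences of X; for repetition-free X, each subset of
-- X is listed exactly once.
subsets : List ℕ → List (List ℕ)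
subsets []       = [] ∷ []
subsets (x ∷ xs) = map (x ∷_) (subsets xs) ++ subsets xs

-- The default 0 of the maximum is never relevant, as [] is independent.
rank : Model → List ℕ → ℕ
rank M X = max 0 (map length (filter (independent? M) (subsets X)))

------------------------------------------------------------------------
-- The rank reduction problem

record Instance : Set where
  field
    model : Model
    k     : ℕ
    k>0   : 0 < k

open Instance public

-- The inequality is one of integers: no X is admissible if k > r(E).
RankReducing : Model → ℕ → List ℕ → Set
RankReducing M k X =
  Unique X × X ⊆ ground M ×
  + rank M (ground M ∖ X) ℤ.≤ + rank M (ground M) ℤ.- + k

MinimumRankReducing : Model → ℕ → List ℕ → Set
MinimumRankReducing M k X =
  RankReducing M k X × (∀ Y → RankReducing M k Y → length X ≤ length Y)

-- The answer "nothing" is correct only if there is no admissible set.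
RankReductionSolution : Instance → Maybe (List ℕ) → Set
RankReductionSolution I (just X) = MinimumRankReducing (model I) (k I) X
RankReductionSolution I nothing  = ∀ X → ¬ RankReducing (model I) (k I) X

------------------------------------------------------------------------
-- Encodings

-- Numbers are written in binary (with digits 1 and 2, so without leading
-- zeros), least significant digit first.
encodeℕᵇ : ℕᵇ → Tree
encodeℕᵇ ℕᵇ.zero  = nil
encodeℕᵇ 1+[2 n ] = nil ∙ encodeℕᵇ n
encodeℕᵇ 2[1+ n ] = (nil ∙ nil) ∙ encodeℕᵇ n

encodeℕ : ℕ → Tree
encodeℕ n = encodeℕᵇ (fromℕ n)

encodeList : {A : Set} → (A → Tree) → List A → Tree
encodeList encode []       = nil
encodeList encode (x ∷ xs) = encode x ∙ encodeList encode xs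

encodeMaybe : {A : Set} → (A → Tree) → Maybe A → Tree
encodeMaybe encode nothing  = nil
encodeMaybe encode (just x) = nil ∙ encode x

encodeBlock : Block → Tree
encodeBlock B = encodeList encodeℕ (elements B) ∙ encodeℕ (capacity B)

encodeInstance : Instance → Tree
encodeInstance I = encodeList encodeBlock (blocks (model I)) ∙ encodeℕ (k I)

encodeAnswer : Maybe (List ℕ) → Tree
encodeAnswer = encodeMaybe (encodeList encodeℕ)

{-# OPTIONS --safe #-}
module Submission where

-- Removing x of the n elements of a block of capacity d lowers the rank by
-- x ∸ (n ∸ d), so rank reduction is a knapsack problem whose sizes are
-- bounded by the number of elements, which the input lists one by one.
-- Dynamic programming keeps a table N whose j-th entry is a smallest set
-- lowering the rank by at least j.  A block is processed with a second table
-- C, the entries of N extended by the elements of the block removed so far: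
-- n ∸ d elements are put into all entries of C without gain, and each of the
-- other d elements also moves the entries of C up by one index, whereupon N
-- keeps the shorter of the two sets at every index.
--
-- For the running time it suffices that every execution of a while loop
-- makes at most M iterations, where M is the size of the input: the time is
-- then bounded by a polynomial in M that is read off the program text.

open import Defs

open import Algebra.Properties.CommutativeSemigroup using (interchange)
open import Data.Empty using (⊥-elim)
open import Data.Fin using (Fin; #_)
open import Data.Integer as ℤ using (+_)
import Data.Integer.Properties as ℤ
open import Data.List
  using (List; []; _∷_; length; map; concatMap; filter; _ʳ++_; take; drop; reverse; _++_)
open import Data.List.Extrema.Nat using (max≤v⁺; v≤max⁺)
open import Data.List.Membership.Propositional using (_∈_)
open import Data.List.Membership.Propositional.Properties
  using (∈-++⁺ˡ; ∈-++⁺ʳ; ∈-++⁻; ∈-∃++; ∈-filter⁺; ∈-filter⁻; ∈-map⁺; ∈-map⁻)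
open import Data.List.Properties
open import Data.List.Relation.Binary.Disjoint.Propositional using (Disjoint)
open import Data.List.Relation.Binary.Permutation.Propositional
  using (_↭_; ↭-sym; ↭-trans; ↭-reflexive; ↭⇒↭ₛ)
open import Data.List.Relation.Binary.Permutation.Propositional.Properties
  using (∈-resp-↭; ↭-reverse; ++⁺ˡ; ++↭ʳ++)
open import Data.List.Relation.Binary.Permutation.Setoid.Properties using (Unique-resp-↭)
open import Data.List.Relation.Binary.Subset.Propositional using (_⊆_)
open import Data.List.Relation.Unary.All using (All; []; _∷_)
import Data.List.Relation.Unary.All as All
import Data.List.Relation.Unary.All.Properties as All
open import Data.List.Relation.Unary.AllPairs using (AllPairs; []; _∷_)
import Data.List.Relation.Unary.AllPairs as AllPairs
open import Data.List.Relation.Unary.Any using (here; there)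
import Data.List.Relation.Unary.Any as Any
import Data.List.Relation.Unary.Any.Properties as Any
open import Data.List.Relation.Unary.Unique.Propositional using (Unique)
import Data.List.Relation.Unary.Unique.Propositional.Properties as Unique
open import Data.Maybe using (Maybe; just; nothing)
open import Data.Nat
open import Data.Nat.Binary using (ℕᵇ; 2[1+_]; 1+[2_]; fromℕ; fromℕ')
import Data.Nat.Binary as ℕᵇ
open import Data.Nat.Binary.Properties using (fromℕ≡fromℕ')
open import Data.Nat.Properties
open import Data.Nat.Solver using (module +-*-Solver)
open import Data.Product using (∃-syntax; _×_; _,_; proj₁; proj₂)
open import Data.Sum using (_⊎_; inj₁; inj₂)
open import Data.Vec using (lookup; _[_]≔_; []; _∷_)
open import Function using (_∘_; id)
open import Relation.Binary.PropositionalEquality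
open import Relation.Nullary using (¬?; yes; no)

open import Data.List.Membership.DecPropositional _≟_ using (_∈?_)

-- Executions with bounded loops

-- The branches of a conditional are added instead of maximised, so the bound is built from sums and
-- products only and `timeBound-poly` can follow the program text.
timeBound : ∀ {n} → ℕ → Cmd n → ℕ
timeBound M skip                 = 1
timeBound M (x ≔ e)              = suc (cost e)
timeBound M (c ⨾ d)              = timeBound M c + timeBound M d
timeBound M (if_then_else e c d) = suc (cost e + (timeBound M c + timeBound M d))
timeBound M (while e c)          = M * suc (cost e + timeBound M c) + suc (cost e)

-- Derivations carry no time, only the iteration count of each execution of a loop. Correctness
-- proofs can thus name a count such as the length of a list and leave all arithmetic on time to
-- `exec⇒run`.
mutual
  data Exec {n : ℕ} (M : ℕ) : Cmd n → Store n → Store n → Set where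
    skip   : ∀ {σ} → Exec M skip σ σ
    assign : ∀ {x e σ} → Exec M (x ≔ e) σ (σ [ x ]≔ eval e σ)
    _⨾_    : ∀ {c d σ τ υ} → Exec M c σ τ → Exec M d τ υ → Exec M (c ⨾ d) σ υ
    then   : ∀ {e c d σ τ} → eval e σ ≢ nil → Exec M c σ τ → Exec M (if_then_else e c d) σ τ
    else   : ∀ {e c d σ τ} → eval e σ ≡ nil → Exec M d σ τ → Exec M (if_then_else e c d) σ τ
    loop   : ∀ {e c i σ τ} → i ≤ M → Iterate M (while e c) i σ τ → Exec M (while e c) σ τ

  data Iterate {n : ℕ} (M : ℕ) : Cmd n → ℕ → Store n → Store n → Set where
    stop : ∀ {e c σ} → eval e σ ≡ nil → Iterate M (while e c) 0 σ σ
    step : ∀ {e c i σ τ υ} → eval e σ ≢ nil → Exec M c σ τ → Iterate M (while e c) i τ υ →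
           Iterate M (while e c) (suc i) σ υ

mutual
  exec⇒run : ∀ {n M} {c : Cmd n} {σ τ} → Exec M c σ τ → ∃[ t ] Run c σ τ t × t ≤ timeBound M c
  exec⇒run skip = _ , run-skip , ≤-refl
  exec⇒run assign = _ , run-assign , ≤-refl
  exec⇒run (p ⨾ q) with exec⇒run p | exec⇒run q
  ... | _ , r , s≤ | _ , r′ , t≤ = _ , run-seq r r′ , +-mono-≤ s≤ t≤
  exec⇒run (then {e} ne p) with exec⇒run p
  ... | _ , r , t≤ = _ , run-then ne r , s≤s (+-monoʳ-≤ (cost e) (≤-trans t≤ (m≤m+n _ _)))
  exec⇒run (else {e} eq p) with exec⇒run p
  ... | _ , r , t≤ = _ , run-else eq r , s≤s (+-monoʳ-≤ (cost e) (≤-trans t≤ (m≤n+m _ _)))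
  exec⇒run (loop i≤M p) with iterate⇒run p
  ... | _ , r , t≤ = _ , r , ≤-trans t≤ (+-monoˡ-≤ _ (*-monoˡ-≤ _ i≤M))

  iterate⇒run : ∀ {n M} {e : Expr n} {c i σ τ} → Iterate M (while e c) i σ τ →
                ∃[ t ] Run (while e c) σ τ t × t ≤ i * suc (cost e + timeBound M c) + suc (cost e)
  iterate⇒run (stop eq) = _ , run-stop eq , ≤-refl
  iterate⇒run {M = M} {e} {c} (step {i = i} ne p ps) with exec⇒run p | iterate⇒run ps
  ... | s , r , s≤ | t , r′ , t≤ = _ , run-loop ne r r′ , (begin
    suc (cost e + (s + t))                  ≡⟨ cong suc (+-assoc (cost e) s t) ⟨
    suc (cost e + s) + t                    ≤⟨ +-mono-≤ (s≤s (+-monoʳ-≤ (cost e) s≤)) t≤ ⟩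
    a + (i * a + suc (cost e))              ≡⟨ +-assoc a (i * a) _ ⟨
    suc i * a + suc (cost e)                ∎)
    where
    open ≤-Reasoning
    a = suc (cost e + timeBound M c)

-- Polynomial bounds

PolynomiallyBounded : (ℕ → ℕ) → Set
PolynomiallyBounded f = ∃[ c ] ∃[ d ] (∀ m → 0 < m → f m ≤ c * m ^ d)

const-poly : ∀ a → PolynomiallyBounded (λ _ → a)
const-poly a = a , 0 , λ m _ → ≤-reflexive (sym (*-identityʳ a))

id-poly : PolynomiallyBounded (λ m → m)
id-poly = 1 , 1 , λ m _ → ≤-reflexive (sym (trans (*-identityˡ _) (*-identityʳ m)))

-- For positive m both `m ^ d` and `m ^ e` are at most `m ^ (d + e)`, so one monomial suffices. This
-- is why bounds are asked for at positive arguments only; sizes of trees are positive.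
+-poly : ∀ {f g} → PolynomiallyBounded f → PolynomiallyBounded g →
         PolynomiallyBounded (λ m → f m + g m)
+-poly {f} {g} (a , d , p) (b , e , q) = a + b , d + e , bound
  where
  bound : ∀ m → 0 < m → f m + g m ≤ (a + b) * m ^ (d + e)
  bound m@(suc _) m>0 = begin
    f m + g m                            ≤⟨ +-mono-≤ (p m m>0) (q m m>0) ⟩
    a * m ^ d + b * m ^ e                ≤⟨ +-mono-≤ (*-monoʳ-≤ a (^-monoʳ-≤ m (m≤m+n d e)))
                                                     (*-monoʳ-≤ b (^-monoʳ-≤ m (m≤n+m e d))) ⟩
    a * m ^ (d + e) + b * m ^ (d + e)    ≡⟨ *-distribʳ-+ (m ^ (d + e)) a b ⟨
    (a + b) * m ^ (d + e)                ∎
    where open ≤-Reasoning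

*-poly : ∀ {f g} → PolynomiallyBounded f → PolynomiallyBounded g →
         PolynomiallyBounded (λ m → f m * g m)
*-poly {f} {g} (a , d , p) (b , e , q) = a * b , d + e , bound
  where
  bound : ∀ m → 0 < m → f m * g m ≤ (a * b) * m ^ (d + e)
  bound m m>0 = begin
    f m * g m                  ≤⟨ *-mono-≤ (p m m>0) (q m m>0) ⟩
    (a * m ^ d) * (b * m ^ e)  ≡⟨ solve 4 (λ a b x y → (a :* x) :* (b :* y) := (a :* b) :* (x :* y))
                                    refl a b (m ^ d) (m ^ e) ⟩
    (a * b) * (m ^ d * m ^ e)  ≡⟨ cong (a * b *_) (^-distribˡ-+-* m d e) ⟨
    (a * b) * m ^ (d + e)      ∎
    where
    open ≤-Reasoning
    open +-*-Solver

timeBound-poly : ∀ {n} (c : Cmd n) → PolynomiallyBounded (λ M → timeBound M c)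
timeBound-poly skip = const-poly 1
timeBound-poly (x ≔ e) = const-poly (suc (cost e))
timeBound-poly (c ⨾ d) = +-poly (timeBound-poly c) (timeBound-poly d)
timeBound-poly (if_then_else e c d) =
  +-poly (const-poly (suc (cost e))) (+-poly (timeBound-poly c) (timeBound-poly d))
timeBound-poly (while e c) =
  +-poly (*-poly id-poly (+-poly (const-poly (suc (cost e))) (timeBound-poly c)))
         (const-poly (suc (cost e)))

-- The program

-- I holds the unread input, K a numeral that is counted down, Z the digits
-- passed by a borrow, E and G the cost and gain elements of a block, N and C the
-- two tables; the other registers are scratch.
vI vK vZ vE vG vN vC vD vB vP vQ : Fin 11
vI = # 0
vK = # 1
vZ = # 2
vE = # 3
vG = # 4
vN = # 5
vC = # 6
vD = # 7
vB = # 8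
vP = # 9
vQ = # 10

-- Subtraction of 1 with digits 1 and 2: low digits 1 are stripped and counted in Z until a 2
-- becomes 1 or the top digit 1 disappears; the stripped digits return as 2s. P flags a pending
-- borrow.
stripOnes replaceTwos decrement : Cmd 11
stripOnes = while (var vP)
  (if_then_else (hd (var vK))
    (vK ≔ cons nil (tl (var vK)) ⨾ vP ≔ nil)
    (if_then_else (tl (var vK))
      (vK ≔ tl (var vK) ⨾ vZ ≔ cons nil (var vZ))
      (vK ≔ nil ⨾ vP ≔ nil)))
replaceTwos = while (var vZ) (vK ≔ cons (cons nil nil) (var vK) ⨾ vZ ≔ tl (var vZ))
decrement = vP ≔ cons nil nil ⨾ stripOnes ⨾ replaceTwos

-- Each pass over a table stacks its results in reverse on D, and unstacking restores the order.
-- `compareLoop` strips two sets in parallel: what is left in Q is not `nil` exactly if the set from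
-- N is strictly shorter. Entries of N beyond the end of C stay in place.
unstackC unstackN insertLoop insertAll compareLoop pick mergeLoop mergeTables gainLoop : Cmd 11
unstackC = while (var vD) (vC ≔ cons (hd (var vD)) (var vC) ⨾ vD ≔ tl (var vD))
unstackN = while (var vD) (vN ≔ cons (hd (var vD)) (var vN) ⨾ vD ≔ tl (var vD))
insertLoop = while (var vC)
  (vD ≔ cons (cons (hd (var vE)) (hd (var vC))) (var vD) ⨾ vC ≔ tl (var vC))
insertAll = insertLoop ⨾ unstackC
compareLoop = while (var vP) (vP ≔ tl (var vP) ⨾ vQ ≔ tl (var vQ))
pick = if_then_else (var vN)
  (vP ≔ hd (var vN) ⨾ vQ ≔ hd (var vB) ⨾ compareLoop ⨾
   if_then_else (var vQ) (vQ ≔ hd (var vN)) (vQ ≔ hd (var vB)))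
  (vQ ≔ hd (var vB))
mergeLoop = while (var vB)
  (pick ⨾ vD ≔ cons (var vQ) (var vD) ⨾ vQ ≔ nil ⨾ vN ≔ tl (var vN) ⨾ vB ≔ tl (var vB))
mergeTables = vB ≔ var vC ⨾ mergeLoop ⨾ unstackN
gainLoop = while (var vE)
  (insertAll ⨾ vC ≔ cons (hd (var vC)) (var vC) ⨾ mergeTables ⨾ vE ≔ tl (var vE))

takeGains costLoop processBlock blockLoop answerLoop solver : Cmd 11
takeGains = while (var vK) (decrement ⨾ vG ≔ cons (hd (var vE)) (var vG) ⨾ vE ≔ tl (var vE))
costLoop = while (var vE) (insertAll ⨾ vE ≔ tl (var vE))
processBlock =
  vK ≔ tl (hd (hd (var vI))) ⨾ vE ≔ hd (hd (hd (var vI))) ⨾ takeGains ⨾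
  vC ≔ var vN ⨾ costLoop ⨾
  vE ≔ var vG ⨾ vG ≔ nil ⨾ gainLoop ⨾
  vC ≔ nil
blockLoop = while (hd (var vI)) (processBlock ⨾ vI ≔ cons (tl (hd (var vI))) (tl (var vI)))
-- K is counted down along the table. If the table ends first, I is still `nil`, which encodes
-- `nothing`; otherwise clearing N ends the loop.
answerLoop = while (var vN)
  (if_then_else (var vK)
    (decrement ⨾ vN ≔ tl (var vN))
    (vI ≔ cons nil (hd (var vN)) ⨾ vN ≔ nil))
solver = vN ≔ cons nil nil ⨾ blockLoop ⨾ vK ≔ tl (var vI) ⨾ vI ≔ nil ⨾ answerLoop

-- The tables computed by the program

Table : Set
Table = List (List ℕ)

-- The test is the one that `compareLoop` performs; ties go to `Y`.
shorter : List ℕ → List ℕ → List ℕ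
shorter X Y with drop (length X) Y
... | []    = Y
... | _ ∷ _ = X

shorter-choice : ∀ X Y → shorter X Y ≡ X ⊎ shorter X Y ≡ Y
shorter-choice X Y with drop (length X) Y
... | []    = inj₂ refl
... | _ ∷ _ = inj₁ refl

merge : Table → Table → Table
merge N       []      = N
merge []      (Y ∷ C) = Y ∷ merge [] C
merge (X ∷ N) (Y ∷ C) = shorter X Y ∷ merge N C

-- A set lowering the rank by at least 1 may also stand at index 0.  The value
-- at [] is what the program computes from nil; it is never relevant.
duplicateHead : Table → Table
duplicateHead []      = [] ∷ []
duplicateHead (X ∷ C) = X ∷ X ∷ C

shift : ℕ → Table → Table
shift x C = duplicateHead (map (x ∷_) C)

addCosts : List ℕ → Table → Table
addCosts []       C = C
addCosts (x ∷ xs) C = addCosts xs (map (x ∷_) C)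

addGains : List ℕ → Table → Table → Table
addGains []       N C = N
addGains (x ∷ xs) N C = addGains xs (merge N (shift x C)) (shift x C)

-- Elements of a block are interchangeable, so any `capacity B` of them may serve as gains. The
-- reversal is the order in which `takeGains` stacks them.
gainElements costElements : Block → List ℕ
gainElements B = reverse (take (capacity B) (elements B))
costElements B = drop (capacity B) (elements B)

addBlock : Block → Table → Table
addBlock B N = addGains (gainElements B) N (addCosts (costElements B) N)

addBlocks : List Block → Table → Table
addBlocks []       N = N
addBlocks (B ∷ Bs) N = addBlocks Bs (addBlock B N)

at : Table → ℕ → Maybe (List ℕ)
at []      _       = nothing
at (X ∷ N) zero    = just X
at (X ∷ N) (suc j) = at N j

optimum : Instance → Maybe (List ℕ)
optimum I = at (addBlocks (blocks (model I)) ([] ∷ [])) (k I)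

-- Finite sets as lists

-- Pigeonhole: delete from `ys` an occurrence of the head of `xs`; by uniqueness the rest of `xs` is
-- still included.
unique-⊆⇒length≤ : ∀ {xs ys : List ℕ} → Unique xs → xs ⊆ ys → length xs ≤ length ys
unique-⊆⇒length≤ {[]}     _        _   = z≤n
unique-⊆⇒length≤ {x ∷ xs} (x∉ ∷ u) sub with ∈-∃++ (sub (here refl))
... | as , bs , refl = begin
  suc (length xs)              ≤⟨ s≤s (unique-⊆⇒length≤ u sub′) ⟩
  suc (length (as ++ bs))      ≡⟨ cong suc (length-++ as) ⟩
  suc (length as + length bs)  ≡⟨ +-suc (length as) (length bs) ⟨
  length as + suc (length bs)  ≡⟨ length-++ as ⟨
  length (as ++ x ∷ bs)        ∎
  where
  open ≤-Reasoning
  sub′ : xs ⊆ as ++ bs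
  sub′ y∈ with ∈-++⁻ as (sub (there y∈))
  ... | inj₁ y∈as         = ∈-++⁺ˡ y∈as
  ... | inj₂ (here refl)  = ⊥-elim (All.lookup x∉ y∈ refl)
  ... | inj₂ (there y∈bs) = ∈-++⁺ʳ as y∈bs

∩-monoʳ : ∀ zs {xs ys} → xs ⊆ ys → ∣ zs ∩ xs ∣ ≤ ∣ zs ∩ ys ∣
∩-monoʳ []       sub = z≤n
∩-monoʳ (z ∷ zs) {xs} {ys} sub with z ∈? xs | z ∈? ys
... | yes z∈ | yes _  = s≤s (∩-monoʳ zs sub)
... | yes z∈ | no z∉  = ⊥-elim (z∉ (sub z∈))
... | no _   | yes _  = m≤n⇒m≤1+n (∩-monoʳ zs sub)
... | no _   | no _   = ∩-monoʳ zs sub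

∩-complement : ∀ zs G Y → zs ⊆ G → ∣ zs ∩ G ∖ Y ∣ + ∣ zs ∩ Y ∣ ≡ length zs
∩-complement []       G Y sub = refl
∩-complement (z ∷ zs) G Y sub with z ∈? (G ∖ Y) | z ∈? Y
... | yes z∈ | yes z∈Y = ⊥-elim (proj₂ (∈-filter⁻ (λ x → ¬? (x ∈? Y)) {xs = G} z∈) z∈Y)
... | yes _  | no _    = cong suc (∩-complement zs G Y (sub ∘ there))
... | no _   | yes _   = trans (+-suc _ _) (cong suc (∩-complement zs G Y (sub ∘ there)))
... | no z∉  | no z∉Y  = ⊥-elim (z∉ (∈-filter⁺ (λ x → ¬? (x ∈? Y)) (sub (here refl)) z∉Y))

filter∈subsets : ∀ S X → filter (_∈? S) X ∈ subsets X
filter∈subsets S []       = here refl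
filter∈subsets S (x ∷ xs) with x ∈? S
... | yes _ = ∈-++⁺ˡ (∈-map⁺ (x ∷_) (filter∈subsets S xs))
... | no _  = ∈-++⁺ʳ (map (x ∷_) (subsets xs)) (filter∈subsets S xs)

subsets-⊆ : ∀ X {S} → S ∈ subsets X → S ⊆ X
subsets-⊆ []       (here refl) ()
subsets-⊆ (x ∷ xs) S∈ y∈ with ∈-++⁻ (map (x ∷_) (subsets xs)) S∈
... | inj₂ S∈′ = there (subsets-⊆ xs S∈′ y∈)
... | inj₁ S∈′ with ∈-map⁻ (x ∷_) S∈′ | y∈
...   | T , T∈ , refl | here eq   = here eq
...   | T , T∈ , refl | there y∈′ = there (subsets-⊆ xs T∈ y∈′)

subsets-unique : ∀ {X S} → Unique X → S ∈ subsets X → Unique S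
subsets-unique {[]}     []       (here refl) = []
subsets-unique {x ∷ xs} (x∉ ∷ u) S∈ with ∈-++⁻ (map (x ∷_) (subsets xs)) S∈
... | inj₂ S∈′ = subsets-unique u S∈′
... | inj₁ S∈′ with ∈-map⁻ (x ∷_) S∈′
...   | T , T∈ , refl =
  All.tabulate (λ y∈ → All.lookup x∉ (subsets-⊆ xs T∈ y∈)) ∷ subsets-unique u T∈

-- Rank of a partition matroid

support : List Block → List ℕ
support = concatMap elements

PairwiseDisjoint : List Block → Set
PairwiseDisjoint = AllPairs (λ B C → Disjoint (elements B) (elements C))

-- `rankSum` is the closed form of the rank. `reduction` is the drop in rank when `Y` is deleted: in
-- each block the first `length (elements B) ∸ capacity B` deletions are free, every further one
-- costs 1.
hits rankSum reduction : List Block → List ℕ → ℕ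
hits []       Y = 0
hits (B ∷ Bs) Y = ∣ elements B ∩ Y ∣ + hits Bs Y
rankSum []       X = 0
rankSum (B ∷ Bs) X = capacity B ⊓ ∣ elements B ∩ X ∣ + rankSum Bs X
reduction []       Y = 0
reduction (B ∷ Bs) Y = (∣ elements B ∩ Y ∣ ∸ (length (elements B) ∸ capacity B)) + reduction Bs Y

disjoint-support : ∀ {xs Bs} → All (λ C → Disjoint xs (elements C)) Bs → Disjoint xs (support Bs)
disjoint-support {Bs = C ∷ Bs} (d ∷ ds) (x∈xs , x∈) with ∈-++⁻ (elements C) x∈
... | inj₁ x∈C  = d (x∈xs , x∈C)
... | inj₂ x∈Bs = disjoint-support ds (x∈xs , x∈Bs)

support-unique : ∀ {Bs} → PairwiseDisjoint Bs → Unique (support Bs)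
support-unique []       = []
support-unique {B ∷ Bs} (d ∷ ds) =
  Unique.++⁺ (elements-unique B) (support-unique ds) (disjoint-support d)

elements⊆support : ∀ {B Bs} → B ∈ Bs → elements B ⊆ support Bs
elements⊆support {Bs = B ∷ Bs} (here refl) = ∈-++⁺ˡ
elements⊆support {Bs = C ∷ Bs} (there B∈)  = ∈-++⁺ʳ (elements C) ∘ elements⊆support B∈

hits-support : ∀ Bs Y → hits Bs Y ≡ ∣ support Bs ∩ Y ∣
hits-support []       Y = refl
hits-support (B ∷ Bs) Y = begin
  ∣ elements B ∩ Y ∣ + hits Bs Y            ≡⟨ cong (λ m → ∣ elements B ∩ Y ∣ + m) (hits-support Bs Y) ⟩
  ∣ elements B ∩ Y ∣ + ∣ support Bs ∩ Y ∣   ≡⟨ length-++ (filter (_∈? Y) (elements B)) ⟨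
  length (filter (_∈? Y) (elements B) ++ filter (_∈? Y) (support Bs))
                                            ≡⟨ cong length (filter-++ (_∈? Y) (elements B) (support Bs)) ⟨
  ∣ support (B ∷ Bs) ∩ Y ∣                  ∎
  where open ≡-Reasoning

hits≤length : ∀ {Bs} → PairwiseDisjoint Bs → ∀ Y → hits Bs Y ≤ length Y
hits≤length {Bs} ds Y = ≤-trans (≤-reflexive (hits-support Bs Y))
  (unique-⊆⇒length≤ (Unique.filter⁺ (_∈? Y) (support-unique ds))
    (λ x∈ → proj₂ (∈-filter⁻ (_∈? Y) {xs = support Bs} x∈)))

length≤hits : ∀ Bs {Y} → Unique Y → Y ⊆ support Bs → length Y ≤ hits Bs Y
length≤hits Bs {Y} u sub = ≤-trans
  (unique-⊆⇒length≤ u (λ x∈ → ∈-filter⁺ (_∈? Y) (sub x∈) x∈))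
  (≤-reflexive (sym (hits-support Bs Y)))

hits≤rankSum : ∀ Bs {S X} → S ⊆ X → All (λ B → ∣ elements B ∩ S ∣ ≤ capacity B) Bs →
               hits Bs S ≤ rankSum Bs X
hits≤rankSum []       sub []       = z≤n
hits≤rankSum (B ∷ Bs) sub (p ∷ ps) =
  +-mono-≤ (⊓-glb p (∩-monoʳ (elements B) sub)) (hits≤rankSum Bs sub ps)

greedyBlock : List ℕ → Block → List ℕ
greedyBlock X B = take (capacity B) (filter (_∈? X) (elements B))

-- A maximum independent subset of `X`: disjoint blocks can be filled up to their capacities
-- separately.
greedy : List Block → List ℕ → List ℕ
greedy Bs X = concatMap (greedyBlock X) Bs

take-⊆ : ∀ m (xs : List ℕ) → take m xs ⊆ xs
take-⊆ (suc m) (x ∷ xs) (here eq)  = here eq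
take-⊆ (suc m) (x ∷ xs) (there y∈) = there (take-⊆ m xs y∈)

greedyBlock-⊆ : ∀ X B {x} → x ∈ greedyBlock X B → x ∈ elements B × x ∈ X
greedyBlock-⊆ X B x∈ = ∈-filter⁻ (_∈? X) (take-⊆ (capacity B) _ x∈)

greedy-⊆ : ∀ Bs X {x} → x ∈ greedy Bs X → x ∈ support Bs × x ∈ X
greedy-⊆ (B ∷ Bs) X x∈ with ∈-++⁻ (greedyBlock X B) x∈
... | inj₁ x∈B  = let x∈E , x∈X = greedyBlock-⊆ X B x∈B in ∈-++⁺ˡ x∈E , x∈X
... | inj₂ x∈Bs = let x∈E , x∈X = greedy-⊆ Bs X x∈Bs in ∈-++⁺ʳ (elements B) x∈E , x∈X

greedy-unique : ∀ {Bs} → PairwiseDisjoint Bs → ∀ X → Unique (greedy Bs X)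
greedy-unique []                X = []
greedy-unique {B ∷ Bs} (d ∷ ds) X =
  Unique.++⁺ (Unique.take⁺ (capacity B) (Unique.filter⁺ (_∈? X) (elements-unique B)))
    (greedy-unique ds X)
    (λ (x∈B , x∈Bs) → disjoint-support d (proj₁ (greedyBlock-⊆ X B x∈B) , proj₁ (greedy-⊆ Bs X x∈Bs)))

length-greedy : ∀ Bs X → length (greedy Bs X) ≡ rankSum Bs X
length-greedy []       X = refl
length-greedy (B ∷ Bs) X = trans (length-++ (greedyBlock X B))
  (cong₂ _+_ (length-take (capacity B) (filter (_∈? X) (elements B))) (length-greedy Bs X))

greedy-∩-elements : ∀ {B Bs} → PairwiseDisjoint Bs → ∀ X → B ∈ Bs →
  ∀ {x} → x ∈ elements B → x ∈ greedy Bs X → x ∈ greedyBlock X B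
greedy-∩-elements {Bs = C ∷ Bs} (d ∷ ds) X B∈ x∈B x∈ with B∈ | ∈-++⁻ (greedyBlock X C) x∈
... | here refl | inj₁ x∈C  = x∈C
... | here refl | inj₂ x∈Bs = ⊥-elim (disjoint-support d (x∈B , proj₁ (greedy-⊆ Bs X x∈Bs)))
... | there B∈′ | inj₁ x∈C  =
  ⊥-elim (disjoint-support d (proj₁ (greedyBlock-⊆ X C x∈C) , elements⊆support B∈′ x∈B))
... | there B∈′ | inj₂ x∈Bs = greedy-∩-elements ds X B∈′ x∈B x∈Bs

rank≡rankSum : ∀ M {X} → Unique X → X ⊆ ground M → rank M X ≡ rankSum (blocks M) X
rank≡rankSum M {X} u sub = ≤-antisym upper lower
  where
  -- `rank` ranges over subsequences of `X`, so the greedy set is rearranged into the order of `X`.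
  S = filter (_∈? greedy (blocks M) X) X

  S-independent : Independent M S
  S-independent = (λ x∈ → sub (proj₁ (∈-filter⁻ (_∈? greedy (blocks M) X) {xs = X} x∈))) ,
    All.tabulate bound
    where
    bound : ∀ {B} → B ∈ blocks M → ∣ elements B ∩ S ∣ ≤ capacity B
    bound {B} B∈ = begin
      ∣ elements B ∩ S ∣         ≤⟨ unique-⊆⇒length≤ (Unique.filter⁺ (_∈? S) (elements-unique B)) inGreedy ⟩
      length (greedyBlock X B)   ≡⟨ length-take (capacity B) _ ⟩
      capacity B ⊓ _             ≤⟨ m⊓n≤m (capacity B) _ ⟩
      capacity B                 ∎
      where
      open ≤-Reasoning
      inGreedy : filter (_∈? S) (elements B) ⊆ greedyBlock X B
      inGreedy x∈ =
        let x∈B , x∈S = ∈-filter⁻ (_∈? S) {xs = elements B} x∈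
        in greedy-∩-elements (blocks-disjoint M) X B∈ x∈B (proj₂ (∈-filter⁻ (_∈? greedy (blocks M) X) {xs = X} x∈S))

  lower : rankSum (blocks M) X ≤ rank M X
  lower = v≤max⁺ 0 _ (inj₂ (Any.map⁺ (Any.map (λ { refl → S-large })
    (∈-filter⁺ (independent? M) (filter∈subsets (greedy (blocks M) X) X) S-independent))))
    where
    S-large : rankSum (blocks M) X ≤ length S
    S-large = ≤-trans (≤-reflexive (sym (length-greedy (blocks M) X)))
      (unique-⊆⇒length≤ (greedy-unique (blocks-disjoint M) X)
        (λ x∈ → ∈-filter⁺ (_∈? greedy (blocks M) X) (proj₂ (greedy-⊆ (blocks M) X x∈)) x∈))

  upper : rank M X ≤ rankSum (blocks M) X
  upper = max≤v⁺ z≤n (All.map⁺ (All.tabulate independent-small))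
    where
    independent-small : ∀ {T} → T ∈ filter (independent? M) (subsets X) → length T ≤ rankSum (blocks M) X
    independent-small T∈ with ∈-filter⁻ (independent? M) {xs = subsets X} T∈
    ... | T∈X , T⊆E , caps = ≤-trans (length≤hits (blocks M) (subsets-unique u T∈X) T⊆E)
      (hits≤rankSum (blocks M) (subsets-⊆ X T∈X) caps)

-- If at least d elements remain, the x removed ones stay within the slack `n ∸ d` and nothing is
-- lost. Otherwise all r remaining ones count, and the slack is used up, so the subtraction is not
-- truncated.
capacity-split : ∀ {d n r x} → d ≤ n → r + x ≡ n → d ⊓ r + (x ∸ (n ∸ d)) ≡ d
capacity-split {d} {n} {r} {x} d≤n r+x≡n with ≤-total d r
... | inj₁ d≤r = begin
  d ⊓ r + (x ∸ (n ∸ d))  ≡⟨ cong₂ _+_ (m≤n⇒m⊓n≡m d≤r) (m≤n⇒m∸n≡0 x≤) ⟩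
  d + 0                  ≡⟨ +-identityʳ d ⟩
  d                      ∎
  where
  open ≡-Reasoning
  x≤ : x ≤ n ∸ d
  x≤ = ≤-trans (≤-reflexive (trans (sym (m+n∸m≡n r x)) (cong (_∸ r) r+x≡n))) (∸-monoʳ-≤ n d≤r)
... | inj₂ r≤d = begin
  d ⊓ r + (x ∸ (n ∸ d))    ≡⟨ cong (_+ (x ∸ (n ∸ d))) (m≥n⇒m⊓n≡n r≤d) ⟩
  r + (x ∸ (n ∸ d))        ≡⟨ +-∸-assoc r n∸d≤x ⟨
  r + x ∸ (n ∸ d)          ≡⟨ cong (_∸ (n ∸ d)) r+x≡n ⟩
  n ∸ (n ∸ d)              ≡⟨ m∸[m∸n]≡n d≤n ⟩
  d                        ∎
  where
  open ≡-Reasoning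
  n∸d≤x : n ∸ d ≤ x
  n∸d≤x = ≤-trans (∸-monoʳ-≤ n r≤d) (≤-reflexive (trans (cong (_∸ r) (sym r+x≡n)) (m+n∸m≡n r x)))

rankSum-split : ∀ Bs G Y → (∀ {B} → B ∈ Bs → elements B ⊆ G) →
                rankSum Bs (G ∖ Y) + reduction Bs Y ≡ rankSum Bs G
rankSum-split []       G Y sub = refl
rankSum-split (B ∷ Bs) G Y sub = begin
  (d ⊓ ∣ E ∩ G ∖ Y ∣ + rankSum Bs (G ∖ Y)) + ((∣ E ∩ Y ∣ ∸ (n ∸ d)) + reduction Bs Y)
    ≡⟨ interchange +-commutativeSemigroup (d ⊓ ∣ E ∩ G ∖ Y ∣) _ _ _ ⟩
  (d ⊓ ∣ E ∩ G ∖ Y ∣ + (∣ E ∩ Y ∣ ∸ (n ∸ d))) + (rankSum Bs (G ∖ Y) + reduction Bs Y)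
    ≡⟨ cong₂ _+_ (capacity-split (capacity≤elements B) (∩-complement E G Y (sub (here refl))))
                 (rankSum-split Bs G Y (sub ∘ there)) ⟩
  d + rankSum Bs G
    ≡⟨ cong (_+ rankSum Bs G) (m≤n⇒m⊓n≡m (capacity≤elements B)) ⟨
  d ⊓ n + rankSum Bs G
    ≡⟨ cong (λ m → d ⊓ m + rankSum Bs G) (cong length (filter-all (_∈? G) (All.tabulate (sub (here refl))))) ⟨
  d ⊓ ∣ E ∩ G ∣ + rankSum Bs G ∎
  where
  open ≡-Reasoning
  E = elements B
  d = capacity B
  n = length E

rank-reduction : ∀ M Y → rank M (ground M ∖ Y) + reduction (blocks M) Y ≡ rank M (ground M)
rank-reduction M Y = begin
  rank M (G ∖ Y) + reduction (blocks M) Y              ≡⟨ cong (_+ reduction (blocks M) Y) (rank≡rankSum M (Unique.filter⁺ (λ x → ¬? (x ∈? Y)) G-unique)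
                                                          (λ x∈ → proj₁ (∈-filter⁻ (λ x → ¬? (x ∈? Y)) {xs = G} x∈))) ⟩
  rankSum (blocks M) (G ∖ Y) + reduction (blocks M) Y  ≡⟨ rankSum-split (blocks M) G Y elements⊆support ⟩
  rankSum (blocks M) G                                 ≡⟨ rank≡rankSum M G-unique id ⟨
  rank M G                                             ∎
  where
  open ≡-Reasoning
  G = ground M
  G-unique = support-unique (blocks-disjoint M)

-- Correctness of the tables

-- The half of correctness that bounds lengths: the entry is no longer than some competitor of size
-- `s`. What an entry achieves is the matter of `Extends`.
Covers : Table → ℕ → ℕ → Set
Covers N j s = ∃[ X ] at N j ≡ just X × length X ≤ s

covers-mono : ∀ N {j s s′} → s ≤ s′ → Covers N j s → Covers N j s′
covers-mono N s≤ (X , eq , X≤) = X , eq , ≤-trans X≤ s≤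

covers-map : ∀ x C {j s} → Covers C j s → Covers (map (x ∷_) C) j (suc s)
covers-map x (X ∷ C) {zero}  (_ , refl , X≤) = x ∷ X , refl , s≤s X≤
covers-map x (X ∷ C) {suc j} cov             = covers-map x C cov

covers-duplicateHead : ∀ C {j s} → Covers C j s → Covers (duplicateHead C) (suc j) s
covers-duplicateHead (X ∷ C) cov = cov

-- Being covered at index 0 amounts to being nonempty; the size is irrelevant where this is used.
covers-head : ∀ C → ∃[ s ] Covers (duplicateHead C) 0 s
covers-head []      = 0 , [] , refl , z≤n
covers-head (X ∷ C) = length X , X , refl , ≤-refl

length-shorter : ∀ X Y → length (shorter X Y) ≤ length X × length (shorter X Y) ≤ length Y
length-shorter X Y with drop (length X) Y in eq
... | []    = m∸n≡0⇒m≤n (trans (sym (length-drop (length X) Y)) (cong length eq)) , ≤-refl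
... | z ∷ Z = ≤-refl , <⇒≤ (m∸n≢0⇒n<m λ 0≡ → 1+n≢0 (trans (cong length (sym eq)) (trans (length-drop (length X) Y) 0≡)))

covers-mergeˡ : ∀ N C {j s} → Covers N j s → Covers (merge N C) j s
covers-mergeˡ N       []      cov = cov
covers-mergeˡ (X ∷ N) (Y ∷ C) {zero}  (_ , refl , X≤) =
  shorter X Y , refl , ≤-trans (proj₁ (length-shorter X Y)) X≤
covers-mergeˡ (X ∷ N) (Y ∷ C) {suc j} cov = covers-mergeˡ N C cov

covers-mergeʳ : ∀ N C {j s} → Covers C j s → Covers (merge N C) j s
covers-mergeʳ []      (Y ∷ C) {zero}  cov = cov
covers-mergeʳ []      (Y ∷ C) {suc j} cov = covers-mergeʳ [] C cov
covers-mergeʳ (X ∷ N) (Y ∷ C) {zero}  (_ , refl , Y≤) =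
  shorter X Y , refl , ≤-trans (proj₂ (length-shorter X Y)) Y≤
covers-mergeʳ (X ∷ N) (Y ∷ C) {suc j} cov = covers-mergeʳ N C cov

covers-addCosts : ∀ xs C {j s} → Covers C j s → Covers (addCosts xs C) j (length xs + s)
covers-addCosts []       C cov = cov
covers-addCosts (x ∷ xs) C {j} {s} cov = covers-mono (addCosts xs (map (x ∷_) C))
  (≤-reflexive (+-suc (length xs) s)) (covers-addCosts xs (map (x ∷_) C) (covers-map x C cov))

covers-addGains-skip : ∀ xs N C {j s} → Covers N j s → Covers (addGains xs N C) j s
covers-addGains-skip []       N C cov = cov
covers-addGains-skip (x ∷ xs) N C cov =
  covers-addGains-skip xs _ (shift x C) (covers-mergeˡ N (shift x C) cov)

-- After `suc q` gains the entry has moved up by `suc q` in the second table and is merged into the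
-- first; later merges can only shorten it.
covers-addGains : ∀ xs N C q {j s} → q < length xs → Covers C j s →
                  Covers (addGains xs N C) (suc q + j) (suc q + s)
covers-addGains (x ∷ xs) N C zero    q< cov =
  covers-addGains-skip xs _ (shift x C)
    (covers-mergeʳ N (shift x C) (covers-duplicateHead (map (x ∷_) C) (covers-map x C cov)))
covers-addGains (x ∷ xs) N C (suc q) {j} {s} (s≤s q<) cov =
  subst₂ (Covers (addGains (x ∷ xs) N C)) (cong suc (+-suc q j)) (cong suc (+-suc q s))
    (covers-addGains xs _ (shift x C) q q< (covers-duplicateHead (map (x ∷_) C) (covers-map x C cov)))

length-gainElements : ∀ B → length (gainElements B) ≡ capacity B
length-gainElements B = trans (length-reverse (take (capacity B) (elements B)))
  (trans (length-take (capacity B) (elements B)) (m≤n⇒m⊓n≡m (capacity≤elements B)))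

length-costElements : ∀ B → length (costElements B) ≡ length (elements B) ∸ capacity B
length-costElements B = length-drop (capacity B) (elements B)

-- A positive gain q forces x to be at least q plus the slack, which is just what all cost elements
-- and q gain elements amount to. For q = 0 the block is left alone.
covers-addBlock : ∀ B N q {j s x} → Covers N j s → q ≤ capacity B →
  q ≤ x ∸ (length (elements B) ∸ capacity B) → Covers (addBlock B N) (q + j) (x + s)
covers-addBlock B N zero    {s = s} {x} cov _ _ =
  covers-mono (addBlock B N) (m≤n+m s x) (covers-addGains-skip (gainElements B) N _ cov)
covers-addBlock B N (suc q) {j} {s} {x} cov q<d q<x =
  covers-mono (addBlock B N) bound
    (covers-addGains (gainElements B) N _ q (≤-trans q<d (≤-reflexive (sym (length-gainElements B))))
      (covers-addCosts (costElements B) N cov))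
  where
  c = length (elements B) ∸ capacity B
  bound : suc q + (length (costElements B) + s) ≤ x + s
  bound = begin
    suc q + (length (costElements B) + s)  ≡⟨ cong (λ m → suc q + (m + s)) (length-costElements B) ⟩
    suc q + (c + s)                        ≡⟨ +-assoc (suc q) c s ⟨
    suc q + c + s                          ≤⟨ +-monoˡ-≤ s (m≤n∸o⇒m+o≤n (<⇒≤ (m<n∸o⇒o<n q<x)) q<x) ⟩
    x + s                                  ∎
    where
    open ≤-Reasoning
    m<n∸o⇒o<n : q < x ∸ c → c < x
    m<n∸o⇒o<n q< = m∸n≢0⇒n<m (λ 0≡ → n≮0 (≤-trans q< (≤-reflexive 0≡)))
    m≤n∸o⇒m+o≤n : ∀ {m} → c ≤ x → m ≤ x ∸ c → m + c ≤ x
    m≤n∸o⇒m+o≤n c≤x m≤ = ≤-trans (+-monoˡ-≤ c m≤) (≤-reflexive (m∸n+n≡m c≤x))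

-- Only the number of elements of `Y` in each block matters, so the tables can imitate any
-- competitor `Y` block by block.
covers-addBlocks : ∀ Bs N Y r {j s} → Covers N j s → r ≤ reduction Bs Y →
                   Covers (addBlocks Bs N) (r + j) (hits Bs Y + s)
covers-addBlocks []       N Y zero cov _  = cov
covers-addBlocks (B ∷ Bs) N Y r {j} {s} cov r≤ =
  subst₂ (Covers (addBlocks Bs (addBlock B N))) index cardinality
    -- This block may lower the rank by more than is asked for: it contributes `a ⊓ r`, and the
    -- later blocks owe `r ∸ a`.
    (covers-addBlocks Bs (addBlock B N) Y (r ∸ a)
      (covers-addBlock B N (a ⊓ r) cov (≤-trans (m⊓n≤m a r) a≤d) (m⊓n≤m a r))
      (≤-trans (∸-monoˡ-≤ a r≤) (≤-reflexive (m+n∸m≡n a _))))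
  where
  x = ∣ elements B ∩ Y ∣
  a = x ∸ (length (elements B) ∸ capacity B)
  a≤d : a ≤ capacity B
  a≤d = ≤-trans (∸-monoˡ-≤ (length (elements B) ∸ capacity B) (length-filter (_∈? Y) (elements B)))
    (≤-reflexive (m∸[m∸n]≡n (capacity≤elements B)))
  index : r ∸ a + (a ⊓ r + j) ≡ r + j
  index = trans (sym (+-assoc (r ∸ a) _ j))
    (cong (_+ j) (trans (+-comm (r ∸ a) (a ⊓ r)) (m⊓n+n∸m≡n a r)))
  cardinality : hits Bs Y + (x + s) ≡ x + hits Bs Y + s
  cardinality = trans (sym (+-assoc (hits Bs Y) x s)) (cong (_+ s) (+-comm (hits Bs Y) x))

-- What the entries of the tables achieve

Everywhere : (ℕ → List ℕ → Set) → Table → Set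
Everywhere P N = ∀ j X → at N j ≡ just X → P j X

-- The elements A lower the rank of the current block by r, the entry of N that of
-- the earlier blocks by at least j ∸ r.
Extends : Table → List ℕ → ℕ → ℕ → List ℕ → Set
Extends N A r j X = ∃[ j₀ ] ∃[ Z ] at N j₀ ≡ just Z × X ≡ A ++ Z × j ≤ r + j₀

at-map : ∀ (f : List ℕ → List ℕ) C j {X} → at (map f C) j ≡ just X → ∃[ Y ] at C j ≡ just Y × X ≡ f Y
at-map f (Y ∷ C) zero    refl = Y , refl , refl
at-map f (Y ∷ C) (suc j) eq   = at-map f C j eq

-- Indices 0 and 1 both hold the old head, so `pred` treats all indices alike. The covering
-- hypothesis excludes the empty table.
at-duplicateHead : ∀ C j {s X} → Covers C 0 s → at (duplicateHead C) j ≡ just X → at C (pred j) ≡ just X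
at-duplicateHead (Y ∷ C) zero    _ eq = eq
at-duplicateHead (Y ∷ C) (suc j) _ eq = eq

at-merge : ∀ N C j {X} → at (merge N C) j ≡ just X → at N j ≡ just X ⊎ at C j ≡ just X
at-merge N       []      j       eq = inj₁ eq
at-merge []      (Y ∷ C) zero    eq = inj₂ eq
at-merge []      (Y ∷ C) (suc j) eq = at-merge [] C j eq
at-merge (X ∷ N) (Y ∷ C) zero    eq with shorter-choice X Y
... | inj₁ isX = inj₁ (trans (cong just (sym isX)) eq)
... | inj₂ isY = inj₂ (trans (cong just (sym isY)) eq)
at-merge (X ∷ N) (Y ∷ C) (suc j) eq = at-merge N C j eq

extends-addCosts : ∀ N {r} xs A C → Everywhere (Extends N A r) C →
                   Everywhere (Extends N (xs ʳ++ A) r) (addCosts xs C)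
extends-addCosts N     []       A C ext = ext
extends-addCosts N {r} (x ∷ xs) A C ext = extends-addCosts N xs (x ∷ A) (map (x ∷_) C) ext′
  where
  ext′ : Everywhere (Extends N (x ∷ A) r) (map (x ∷_) C)
  ext′ j X eq with at-map (x ∷_) C j eq
  ... | Y , eqY , refl with ext j Y eqY
  ...   | j₀ , Z , eqZ , refl , j≤ = j₀ , Z , eqZ , refl , j≤

extends-shift : ∀ N {A r s} x C → Covers C 0 s → Everywhere (Extends N A r) C →
                Everywhere (Extends N (x ∷ A) (suc r)) (shift x C)
extends-shift N x C cov ext j X eq
  with at-map (x ∷_) C (pred j) (at-duplicateHead (map (x ∷_) C) j (covers-map x C cov) eq)
... | Y , eqY , refl with ext (pred j) Y eqY
...   | j₀ , Z , eqZ , refl , j≤ = j₀ , Z , eqZ , refl , ≤-trans (suc-pred≤ j) (s≤s j≤)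
  where
  suc-pred≤ : ∀ j → j ≤ suc (pred j)
  suc-pred≤ zero    = z≤n
  suc-pred≤ (suc j) = ≤-refl

-- Merging mixes entries from different stages of the block, so here `A` and `r` depend on the
-- entry, whereas they are fixed throughout the second table.
BlockExtends : Block → Table → ℕ → List ℕ → Set
BlockExtends B N j X = ∃[ A ] ∃[ r ] Unique A × A ⊆ elements B ×
  r ≤ length A ∸ (length (elements B) ∸ capacity B) × Extends N A r j X

unique-ʳ++⁻ : ∀ (xs : List ℕ) {ys} → Unique (xs ʳ++ ys) → Unique ys
unique-ʳ++⁻ []       u = u
unique-ʳ++⁻ (x ∷ xs) u = AllPairs.tail (unique-ʳ++⁻ xs u)

-- Uniqueness and inclusion are stated for `xs ʳ++ A`, the elements inserted by the end of the loop,
-- because this list is the same at every step. The inequality says that `A` has paid for the slack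
-- as well as for the gain `r`.
extends-addGains : ∀ B N₀ xs A r N C {s} → Unique (xs ʳ++ A) → xs ʳ++ A ⊆ elements B →
  r + (length (elements B) ∸ capacity B) ≤ length A → Covers C 0 s →
  Everywhere (BlockExtends B N₀) N → Everywhere (Extends N₀ A r) C →
  Everywhere (BlockExtends B N₀) (addGains xs N C)
extends-addGains B N₀ []       A r N C u sub len cov extN extC = extN
extends-addGains B N₀ (x ∷ xs) A r N C u sub len cov extN extC =
  extends-addGains B N₀ xs (x ∷ A) (suc r) (merge N C′) C′ u sub (s≤s len)
    (proj₂ (covers-head (map (x ∷_) C))) extN′ extC′
  where
  C′ = shift x C
  c  = length (elements B) ∸ capacity B
  extC′ : Everywhere (Extends N₀ (x ∷ A) (suc r)) C′
  extC′ = extends-shift N₀ x C cov extC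
  extN′ : Everywhere (BlockExtends B N₀) (merge N C′)
  extN′ j X eq with at-merge N C′ j eq
  ... | inj₁ eqN = extN j X eqN
  ... | inj₂ eqC = x ∷ A , suc r , unique-ʳ++⁻ xs u , sub ∘ ∈-resp-↭ (++↭ʳ++ xs _) ∘ ∈-++⁺ʳ xs ,
    ≤-trans (≤-reflexive (sym (m+n∸n≡m (suc r) c))) (∸-monoˡ-≤ c (s≤s len)) , extC′ j X eqC

rearranged : ∀ B → gainElements B ʳ++ (costElements B ʳ++ []) ↭ elements B
rearranged B = ↭-trans
  (↭-reflexive (ʳ++-ʳ++ (take (capacity B) (elements B))))
  (↭-trans (++⁺ˡ (take (capacity B) (elements B)) (↭-reverse (costElements B)))
    (↭-reflexive (take++drop≡id (capacity B) (elements B))))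

extends-addBlock : ∀ B N {s} → Covers N 0 s → Everywhere (BlockExtends B N) (addBlock B N)
extends-addBlock B N cov = extends-addGains B N (gainElements B) (costElements B ʳ++ []) 0 N
  (addCosts (costElements B) N)
  (Unique-resp-↭ (setoid ℕ) (↭⇒↭ₛ (↭-sym (rearranged B))) (elements-unique B))
  (∈-resp-↭ (rearranged B))
  -- The cost elements fill the slack exactly, so the gain starts at 0.
  (≤-reflexive (sym (trans (length-reverse (costElements B)) (length-costElements B))))
  (covers-addCosts (costElements B) N cov)
  (λ j X eq → [] , 0 , [] , (λ ()) , z≤n , j , X , eq , refl , ≤-refl)
  (extends-addCosts N (costElements B) [] N (λ j X eq → j , X , eq , refl , ≤-refl))

reduction-mono : ∀ Bs {X Y} → X ⊆ Y → reduction Bs X ≤ reduction Bs Y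
reduction-mono []       sub = z≤n
reduction-mono (B ∷ Bs) sub =
  +-mono-≤ (∸-monoˡ-≤ (length (elements B) ∸ capacity B) (∩-monoʳ (elements B) sub))
           (reduction-mono Bs sub)

BlocksExtend : List Block → Table → ℕ → List ℕ → Set
BlocksExtend Bs N j X = ∃[ j₀ ] ∃[ Z ] ∃[ A ] at N j₀ ≡ just Z × X ≡ A ++ Z ×
  Unique A × A ⊆ support Bs × j ≤ reduction Bs A + j₀

-- An entry is traced back from the last block to the first. The parts `A` and `A′` are disjoint
-- because the blocks are, and the gains add up because `reduction` is monotone.
extends-addBlocks : ∀ {Bs} → PairwiseDisjoint Bs → ∀ N {s} → Covers N 0 s →
                    Everywhere (BlocksExtend Bs N) (addBlocks Bs N)
extends-addBlocks {[]}     []       N cov j X eq = j , X , [] , eq , refl , [] , (λ ()) , ≤-refl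
extends-addBlocks {B ∷ Bs} (d ∷ ds) N cov j X eq
  with extends-addBlocks ds (addBlock B N) (covers-addBlock B N 0 {x = 0} cov z≤n z≤n) j X eq
... | j₁ , Z , A , eqZ , refl , u , sub , j≤ with extends-addBlock B N cov j₁ Z eqZ
...   | A′ , r , u′ , sub′ , r≤ , j₀ , Z′ , eqN , refl , j₁≤ =
  j₀ , Z′ , A ++ A′ , eqN , sym (++-assoc A A′ Z′) ,
  Unique.++⁺ u u′ (λ (x∈A , x∈A′) → disjoint-support d (sub′ x∈A′ , sub x∈A)) ,
  inSupport , enough
  where
  inSupport : A ++ A′ ⊆ support (B ∷ Bs)
  inSupport x∈ with ∈-++⁻ A x∈
  ... | inj₁ x∈A  = ∈-++⁺ʳ (elements B) (sub x∈A)
  ... | inj₂ x∈A′ = ∈-++⁺ˡ (sub′ x∈A′)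
  c = length (elements B) ∸ capacity B
  A′-in-B : length A′ ≤ ∣ elements B ∩ (A ++ A′) ∣
  A′-in-B = unique-⊆⇒length≤ u′ (λ x∈ → ∈-filter⁺ (_∈? (A ++ A′)) (sub′ x∈) (∈-++⁺ʳ A x∈))
  enough : j ≤ reduction (B ∷ Bs) (A ++ A′) + j₀
  enough = begin
    j                                              ≤⟨ j≤ ⟩
    reduction Bs A + j₁                            ≤⟨ +-mono-≤ (reduction-mono Bs (∈-++⁺ˡ {xs = A})) j₁≤ ⟩
    reduction Bs (A ++ A′) + (r + j₀)              ≡⟨ solve 3 (λ x y z → x :+ (y :+ z) := (y :+ x) :+ z) refl
                                                        (reduction Bs (A ++ A′)) r j₀ ⟩
    r + reduction Bs (A ++ A′) + j₀                ≤⟨ +-monoˡ-≤ j₀ (+-monoˡ-≤ _ (≤-trans r≤ (∸-monoˡ-≤ c A′-in-B))) ⟩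
    reduction (B ∷ Bs) (A ++ A′) + j₀              ∎
    where
    open ≤-Reasoning
    open +-*-Solver

-- From the integer rank condition to optimality

≤-diff⇒+≤ : ∀ {a b k} → + a ℤ.≤ + b ℤ.- + k → a + k ≤ b
≤-diff⇒+≤ {a} {b} {k} a≤ = ℤ.drop‿+≤+ (begin
  + a ℤ.+ + k             ≤⟨ ℤ.+-monoˡ-≤ (+ k) a≤ ⟩
  + b ℤ.- + k ℤ.+ + k     ≡⟨ ℤ.+-assoc (+ b) (ℤ.- + k) (+ k) ⟩
  + b ℤ.+ (ℤ.- + k ℤ.+ + k) ≡⟨ cong (λ i → + b ℤ.+ i) (ℤ.+-inverseˡ (+ k)) ⟩
  + b ℤ.+ + 0             ≡⟨ ℤ.+-identityʳ (+ b) ⟩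
  + b                     ∎)
  where open ℤ.≤-Reasoning

+≤⇒≤-diff : ∀ {a b k} → a + k ≤ b → + a ℤ.≤ + b ℤ.- + k
+≤⇒≤-diff {a} {b} {k} a+k≤ = begin
  + a                         ≡⟨ ℤ.+-identityʳ (+ a) ⟨
  + a ℤ.+ + 0                 ≡⟨ cong (λ i → + a ℤ.+ i) (ℤ.+-inverseʳ (+ k)) ⟨
  + a ℤ.+ (+ k ℤ.- + k)       ≡⟨ ℤ.+-assoc (+ a) (+ k) (ℤ.- + k) ⟨
  + (a + k) ℤ.- + k           ≤⟨ ℤ.+-monoˡ-≤ (ℤ.- + k) (ℤ.+≤+ a+k≤) ⟩
  + b ℤ.- + k                 ∎
  where open ℤ.≤-Reasoning

reducing⇒k≤reduction : ∀ M {k Y} → RankReducing M k Y → k ≤ reduction (blocks M) Y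
reducing⇒k≤reduction M {k} {Y} (_ , _ , r≤) = +-cancelˡ-≤ (rank M (ground M ∖ Y)) _ _
  (≤-trans (≤-diff⇒+≤ r≤) (≤-reflexive (sym (rank-reduction M Y))))

k≤reduction⇒reducing : ∀ M {k Y} → Unique Y → Y ⊆ ground M → k ≤ reduction (blocks M) Y →
                       RankReducing M k Y
k≤reduction⇒reducing M {k} {Y} u sub k≤ = u , sub , +≤⇒≤-diff
  (≤-trans (+-monoʳ-≤ (rank M (ground M ∖ Y)) k≤) (≤-reflexive (rank-reduction M Y)))

-- Serves both answers: it refutes every admissible set if the entry is missing, and gives
-- minimality if it is present.
optimum-covers : ∀ I Y → RankReducing (model I) (k I) Y →
               ∃[ X ] optimum I ≡ just X × length X ≤ length Y
optimum-covers I Y red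
  with covers-addBlocks (blocks (model I)) ([] ∷ []) Y (k I) {0} {0} ([] , refl , z≤n)
         (reducing⇒k≤reduction (model I) red)
... | X , eq , X≤ rewrite +-identityʳ (k I) | +-identityʳ (hits (blocks (model I)) Y) =
  X , eq , ≤-trans X≤ (hits≤length (blocks-disjoint (model I)) Y)

optimum-reducing : ∀ I {X} → optimum I ≡ just X → RankReducing (model I) (k I) X
optimum-reducing I {X} eq
  with extends-addBlocks (blocks-disjoint (model I)) ([] ∷ []) {s = 0} ([] , refl , z≤n) (k I) X eq
-- The start table has an entry at index 0 only, namely the empty set.
... | zero , Z , A , refl , refl , u , sub , k≤ rewrite ++-identityʳ A =
  k≤reduction⇒reducing (model I) u sub (≤-trans k≤ (≤-reflexive (+-identityʳ _)))

optimum-correct : ∀ I → RankReductionSolution I (optimum I)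
optimum-correct I with optimum I in eq
... | nothing = λ Y red → nothing≢just (trans (sym eq) (proj₁ (proj₂ (optimum-covers I Y red))))
  where
  nothing≢just : ∀ {X : List ℕ} → nothing ≢ just X
  nothing≢just ()
... | just X  = optimum-reducing I eq , minimal
  where
  minimal : ∀ Y → RankReducing (model I) (k I) Y → length X ≤ length Y
  minimal Y red with optimum-covers I Y red
  ... | X′ , eq′ , X′≤ with trans (sym eq) eq′
  ...   | refl = X′≤

-- Correctness of the program

encodeSet : List ℕ → Tree
encodeSet = encodeList encodeℕ

encodeTable : Table → Tree
encodeTable = encodeList encodeSet

store : (i k z e g n c d b p q : Tree) → Store 11
store i k z e g n c d b p q = i ∷ k ∷ z ∷ e ∷ g ∷ n ∷ c ∷ d ∷ b ∷ p ∷ q ∷ []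

private variable
  i κ z e g n c d b p q : Tree

-- Lengths of numerals and of tables

digits : ℕᵇ → ℕ
digits ℕᵇ.zero  = 0
digits 1+[2 m ] = suc (digits m)
digits 2[1+ m ] = suc (digits m)

digits-suc : ∀ m → digits m ≤ digits (ℕᵇ.suc m)
digits-suc ℕᵇ.zero  = z≤n
digits-suc 1+[2 m ] = ≤-refl
digits-suc 2[1+ m ] = s≤s (digits-suc m)

encode-suc≢nil : ∀ m → encodeℕᵇ (ℕᵇ.suc m) ≢ nil
encode-suc≢nil ℕᵇ.zero  ()
encode-suc≢nil 1+[2 m ] ()
encode-suc≢nil 2[1+ m ] ()

-- `fromℕ'` iterates the successor, so it unfolds along a countdown. The crude bound suffices for
-- capacities, which are at most numbers of listed elements.
digits-fromℕ : ∀ m → digits (fromℕ' m) ≤ m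
digits-fromℕ zero    = z≤n
digits-fromℕ (suc m) = ≤-trans (grow (fromℕ' m)) (s≤s (digits-fromℕ m))
  where
  grow : ∀ m → digits (ℕᵇ.suc m) ≤ suc (digits m)
  grow ℕᵇ.zero  = ≤-refl
  grow 1+[2 m ] = n≤1+n _
  grow 2[1+ m ] = s≤s (grow m)

-- A single `m` bounds both dimensions, since inserting an element raises each of them by at most
-- one.
Fits : ℕ → Table → Set
Fits m T = length T ≤ m × All (λ X → length X ≤ m) T

fits-mono : ∀ {m m′ T} → m ≤ m′ → Fits m T → Fits m′ T
fits-mono m≤ (l , a) = ≤-trans l m≤ , All.map (λ h → ≤-trans h m≤) a

fits-map : ∀ {m T} x → Fits m T → Fits (suc m) (map (x ∷_) T)
fits-map {T = T} x (l , a) =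
  ≤-trans (≤-reflexive (length-map (x ∷_) T)) (m≤n⇒m≤1+n l) , All.map⁺ (All.map s≤s a)

fits-shift : ∀ {m T} x → Fits m T → Fits (suc m) (shift x T)
fits-shift {T = []}    x _           = s≤s z≤n , z≤n ∷ []
fits-shift {T = X ∷ T} x (l , p ∷ a) =
  s≤s (≤-trans (≤-reflexive (cong suc (length-map (x ∷_) T))) l) ,
  s≤s p ∷ s≤s p ∷ All.map⁺ (All.map s≤s a)

fits-merge : ∀ {m} N C → Fits m N → Fits m C → Fits m (merge N C)
fits-merge {m} N C (l , a) (l′ , a′) = lengths N C l l′ , members N C a a′
  where
  lengths : ∀ {m} N C → length N ≤ m → length C ≤ m → length (merge N C) ≤ m
  lengths N       []      l       l′       = l
  lengths []      (Y ∷ C) l       (s≤s l′) = s≤s (lengths [] C z≤n l′)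
  lengths (X ∷ N) (Y ∷ C) (s≤s l) (s≤s l′) = s≤s (lengths N C l l′)
  members : ∀ N C → All (λ X → length X ≤ m) N → All (λ X → length X ≤ m) C →
            All (λ X → length X ≤ m) (merge N C)
  members N       []      a       a′       = a
  members []      (Y ∷ C) a       (p ∷ a′) = p ∷ members [] C [] a′
  members (X ∷ N) (Y ∷ C) (o ∷ a) (p ∷ a′) with shorter-choice X Y
  ... | inj₁ eq rewrite eq = o ∷ members N C a a′
  ... | inj₂ eq rewrite eq = p ∷ members N C a a′

fits-addCosts : ∀ {m T} xs → Fits m T → Fits (length xs + m) (addCosts xs T)
fits-addCosts []       f = f
fits-addCosts {m} {T} (x ∷ xs) f = subst (λ j → Fits j (addCosts (x ∷ xs) T)) (+-suc (length xs) m)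
  (fits-addCosts xs (fits-map x f))

fits-addGains : ∀ {m N C} xs → Fits m N → Fits m C → Fits (length xs + m) (addGains xs N C)
fits-addGains []       f f′ = f
fits-addGains {m} {N} {C} (x ∷ xs) f f′ = subst (λ j → Fits j (addGains (x ∷ xs) N C)) (+-suc (length xs) m)
  (fits-addGains xs (fits-merge N _ (fits-mono (n≤1+n m) f) (fits-shift x f′)) (fits-shift x f′))

length-gains-costs : ∀ B m →
  length (gainElements B) + (length (costElements B) + m) ≡ length (elements B) + m
length-gains-costs B m = begin
  length (reverse gs) + (length cs + m)  ≡⟨ cong (_+ (length cs + m)) (length-reverse gs) ⟩
  length gs + (length cs + m)            ≡⟨ +-assoc (length gs) (length cs) m ⟨
  length gs + length cs + m              ≡⟨ cong (_+ m) (length-++ gs) ⟨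
  length (gs ++ cs) + m                  ≡⟨ cong (λ xs → length xs + m) (take++drop≡id (capacity B) (elements B)) ⟩
  length (elements B) + m                ∎
  where
  open ≡-Reasoning
  gs = take (capacity B) (elements B)
  cs = costElements B

length-ground-∷ : ∀ B Bs m → length (concatMap elements Bs) + (length (elements B) + m) ≡
                             length (concatMap elements (B ∷ Bs)) + m
length-ground-∷ B Bs m = begin
  length (concatMap elements Bs) + (length (elements B) + m)
    ≡⟨ solve 3 (λ x y z → x :+ (y :+ z) := (y :+ x) :+ z) refl
         (length (concatMap elements Bs)) (length (elements B)) m ⟩
  length (elements B) + length (concatMap elements Bs) + m
    ≡⟨ cong (_+ m) (length-++ (elements B)) ⟨
  length (elements B ++ concatMap elements Bs) + m
    ∎
  where
  open ≡-Reasoning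
  open +-*-Solver

fits-addBlock : ∀ {m N} B → Fits m N → Fits (length (elements B) + m) (addBlock B N)
fits-addBlock {m} {N} B f = subst (λ j → Fits j (addBlock B N)) (length-gains-costs B m)
  (fits-addGains (gainElements B) (fits-mono (m≤n+m m (length (costElements B))) f)
    (fits-addCosts (costElements B) f))

fits-addBlocks : ∀ {m N} Bs → Fits m N → Fits (length (concatMap elements Bs) + m) (addBlocks Bs N)
fits-addBlocks []               f = f
fits-addBlocks {m} {N} (B ∷ Bs) f = subst (λ j → Fits j (addBlocks (B ∷ Bs) N))
  (length-ground-∷ B Bs m) (fits-addBlocks Bs (fits-addBlock B f))

-- Puts `l` digits 2 at the low end of `m`: the value of a numeral `m` with `l` stripped digits
-- pending in Z, and hence the invariant of decrementing.
twos : ℕ → ℕᵇ → ℕᵇ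
twos zero    m = m
twos (suc l) m = twos l 2[1+ m ]

ones : ℕ → Tree
ones zero    = nil
ones (suc l) = nil ∙ ones l

-- Executions of the parts of the program

module _ {M : ℕ} where

  replaceTwos-iterate : ∀ l m {m′} → twos l m ≡ m′ → Iterate M replaceTwos l
    (store i (encodeℕᵇ m) (ones l) e g n c d b p q)
    (store i (encodeℕᵇ m′) nil e g n c d b p q)
  replaceTwos-iterate zero    m refl = stop refl
  replaceTwos-iterate (suc l) m eq   = step (λ ()) (assign ⨾ assign) (replaceTwos-iterate l 2[1+ m ] eq)

  -- The borrow passes over the leading digits 1, which become digits 2.
  stripOnes-iterate : ∀ l m → ∃[ l′ ] ∃[ m′ ] twos l′ m′ ≡ twos l m × l′ ≤ l + digits m ×
    ∃[ s ] s ≤ digits (ℕᵇ.suc m) × (∀ {i e g n c d b q} → Iterate M stripOnes s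
      (store i (encodeℕᵇ (ℕᵇ.suc m)) (ones l) e g n c d b (nil ∙ nil) q)
      (store i (encodeℕᵇ m′) (ones l′) e g n c d b nil q))
  stripOnes-iterate l ℕᵇ.zero  = l , ℕᵇ.zero , refl , m≤m+n l 0 , 1 , ≤-refl ,
    step (λ ()) (else refl (else refl (assign ⨾ assign))) (stop refl)
  stripOnes-iterate l 1+[2 m ] = l , 1+[2 m ] , refl , m≤m+n l _ , 1 , s≤s z≤n ,
    step (λ ()) (then (λ ()) (assign ⨾ assign)) (stop refl)
  stripOnes-iterate l 2[1+ m ] with stripOnes-iterate (suc l) m
  ... | l′ , m′ , eq , l′≤ , s , s≤ , r =
    l′ , m′ , eq , ≤-trans l′≤ (≤-reflexive (sym (+-suc l _))) , suc s , s≤s s≤ ,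
    step (λ ()) (else refl (then (encode-suc≢nil m) (assign ⨾ assign))) r

  decrement-exec : ∀ m → digits (ℕᵇ.suc m) ≤ M → Exec M decrement
    (store i (encodeℕᵇ (ℕᵇ.suc m)) nil e g n c d b p q)
    (store i (encodeℕᵇ m) nil e g n c d b nil q)
  decrement-exec m m≤M with stripOnes-iterate 0 m
  ... | l′ , m′ , eq , l′≤ , s , s≤ , r =
    assign ⨾ loop (≤-trans s≤ m≤M) r ⨾
    loop (≤-trans l′≤ (≤-trans (digits-suc m) m≤M)) (replaceTwos-iterate l′ m′ eq)

  unstackC-iterate : ∀ D C {T} → D ʳ++ C ≡ T → Iterate M unstackC (length D)
    (store i κ z e g n (encodeTable C) (encodeTable D) b p q)
    (store i κ z e g n (encodeTable T) nil b p q)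
  unstackC-iterate []      C refl = stop refl
  unstackC-iterate (X ∷ D) C eq   = step (λ ()) (assign ⨾ assign) (unstackC-iterate D (X ∷ C) eq)

  unstackN-iterate : ∀ D N {T} → D ʳ++ N ≡ T → Iterate M unstackN (length D)
    (store i κ z e g (encodeTable N) c (encodeTable D) b p q)
    (store i κ z e g (encodeTable T) c nil b p q)
  unstackN-iterate []      N refl = stop refl
  unstackN-iterate (X ∷ D) N eq   = step (λ ()) (assign ⨾ assign) (unstackN-iterate D (X ∷ N) eq)

  insertLoop-iterate : ∀ x xs T D → Iterate M insertLoop (length T)
    (store i κ z (encodeSet (x ∷ xs)) g n (encodeTable T) (encodeTable D) b p q)
    (store i κ z (encodeSet (x ∷ xs)) g n nil (encodeTable (map (x ∷_) T ʳ++ D)) b p q)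
  insertLoop-iterate x xs []      D = stop refl
  insertLoop-iterate x xs (X ∷ T) D =
    step (λ ()) (assign ⨾ assign) (insertLoop-iterate x xs T ((x ∷ X) ∷ D))

  insertAll-exec : ∀ x xs T → length T ≤ M → Exec M insertAll
    (store i κ z (encodeSet (x ∷ xs)) g n (encodeTable T) nil b p q)
    (store i κ z (encodeSet (x ∷ xs)) g n (encodeTable (map (x ∷_) T)) nil b p q)
  insertAll-exec x xs T T≤M =
    loop T≤M (insertLoop-iterate x xs T []) ⨾
    loop (≤-trans (≤-reflexive lengths) T≤M) (unstackC-iterate (map (x ∷_) T ʳ++ []) [] contents)
    where
    contents : (map (x ∷_) T ʳ++ []) ʳ++ [] ≡ map (x ∷_) T
    contents = trans (ʳ++-ʳ++ (map (x ∷_) T)) (++-identityʳ _)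
    lengths : length (map (x ∷_) T ʳ++ []) ≡ length T
    lengths = trans (length-ʳ++ (map (x ∷_) T)) (trans (+-identityʳ _) (length-map (x ∷_) T))

  compareLoop-iterate : ∀ X Y {Z} → drop (length X) Y ≡ Z → Iterate M compareLoop (length X)
    (store i κ z e g n c d b (encodeSet X) (encodeSet Y))
    (store i κ z e g n c d b nil (encodeSet Z))
  compareLoop-iterate []      Y       refl = stop refl
  compareLoop-iterate (x ∷ X) []      eq   = step (λ ()) (assign ⨾ assign)
    (compareLoop-iterate X [] (trans (drop-[] (length X)) eq))
  compareLoop-iterate (x ∷ X) (y ∷ Y) eq   = step (λ ()) (assign ⨾ assign)
    (compareLoop-iterate X Y eq)

  pick-exec : ∀ X N Y C → length X ≤ M → Exec M pick
    (store i κ z e g (encodeTable (X ∷ N)) c d (encodeTable (Y ∷ C)) nil nil)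
    (store i κ z e g (encodeTable (X ∷ N)) c d (encodeTable (Y ∷ C)) nil (encodeSet (shorter X Y)))
  pick-exec X N Y C X≤M with drop (length X) Y in eq
  ... | []    =
    then (λ ()) (assign ⨾ assign ⨾ loop X≤M (compareLoop-iterate X Y eq) ⨾ else refl assign)
  ... | _ ∷ _ =
    then (λ ()) (assign ⨾ assign ⨾ loop X≤M (compareLoop-iterate X Y eq) ⨾ then (λ ()) assign)

  -- `N′` is the unread rest of `N` and `D′` the stack of merged entries. Only their recombination
  -- matters, together with the length of `D′`, which bounds the unstacking.
  mergeLoop-iterate : ∀ N C D → All (λ X → length X ≤ M) N →
    ∃[ N′ ] ∃[ D′ ] D′ ʳ++ N′ ≡ D ʳ++ merge N C × length D′ ≡ length C + length D ×
    (∀ {i κ z e g c} → Iterate M mergeLoop (length C)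
      (store i κ z e g (encodeTable N) c (encodeTable D) (encodeTable C) nil nil)
      (store i κ z e g (encodeTable N′) c (encodeTable D′) nil nil nil))
  mergeLoop-iterate N       []      D a       = N , D , refl , refl , stop refl
  mergeLoop-iterate []      (Y ∷ C) D a       with mergeLoop-iterate [] C (Y ∷ D) a
  ... | N′ , D′ , eq , len , r = N′ , D′ , eq , trans len (+-suc _ _) ,
    step (λ ()) (else refl assign ⨾ assign ⨾ assign ⨾ assign ⨾ assign) r
  mergeLoop-iterate (X ∷ N) (Y ∷ C) D (l ∷ a) with mergeLoop-iterate N C (shorter X Y ∷ D) a
  ... | N′ , D′ , eq , len , r = N′ , D′ , eq , trans len (+-suc _ _) ,
    step (λ ()) (pick-exec X N Y C l ⨾ assign ⨾ assign ⨾ assign ⨾ assign) r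

  mergeTables-exec : ∀ N C → Fits M N → Fits M C → Exec M mergeTables
    (store i κ z e g (encodeTable N) (encodeTable C) nil nil nil nil)
    (store i κ z e g (encodeTable (merge N C)) (encodeTable C) nil nil nil nil)
  mergeTables-exec N C (_ , a) (C≤M , _) with mergeLoop-iterate N C [] a
  ... | N′ , D′ , eq , len , r =
    assign ⨾ loop C≤M r ⨾
    loop (≤-trans (≤-reflexive (trans len (+-identityʳ _))) C≤M) (unstackN-iterate D′ N′ eq)

  duplicateHead-exec : ∀ C → Exec M (vC ≔ cons (hd (var vC)) (var vC))
    (store i κ z e g n (encodeTable C) d b p q)
    (store i κ z e g n (encodeTable (duplicateHead C)) d b p q)
  duplicateHead-exec []      = assign
  duplicateHead-exec (X ∷ C) = assign

  -- The budget `length xs + m` is invariant: each element processed shortens `xs` and raises the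
  -- bound on the tables by one. The final second table is left unspecified because `processBlock`
  -- clears it.
  gainLoop-iterate : ∀ xs N C {m} → Fits m N → Fits m C → length xs + m ≤ M →
    ∃[ c′ ] (∀ {i κ z g} → Iterate M gainLoop (length xs)
      (store i κ z (encodeSet xs) g (encodeTable N) (encodeTable C) nil nil nil nil)
      (store i κ z nil g (encodeTable (addGains xs N C)) c′ nil nil nil nil))
  gainLoop-iterate []       N C     f f′ m≤M = _ , stop refl
  gainLoop-iterate (x ∷ xs) N C {m} f f′ m≤M
    with gainLoop-iterate xs (merge N (shift x C)) (shift x C)
           (fits-merge N (shift x C) (fits-mono (n≤1+n m) f) (fits-shift x f′)) (fits-shift x f′)
           (≤-trans (≤-reflexive (+-suc (length xs) m)) m≤M)
  ... | c′ , r = c′ , step (λ ())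
    (insertAll-exec x xs C (≤-trans (proj₁ f′) m′≤M) ⨾
     duplicateHead-exec (map (x ∷_) C) ⨾
     mergeTables-exec N (shift x C) (fits-mono m′≤M f) (fits-mono 1+m≤M (fits-shift x f′)) ⨾
     assign) r
    where
    1+m≤M = ≤-trans (s≤s (m≤n+m m (length xs))) m≤M
    m′≤M  = ≤-trans (n≤1+n m) 1+m≤M

  costLoop-iterate : ∀ xs T → length T ≤ M → Iterate M costLoop (length xs)
    (store i κ z (encodeSet xs) g n (encodeTable T) nil b p q)
    (store i κ z nil g n (encodeTable (addCosts xs T)) nil b p q)
  costLoop-iterate []       T T≤M = stop refl
  costLoop-iterate (x ∷ xs) T T≤M = step (λ ()) (insertAll-exec x xs T T≤M ⨾ assign)
    (costLoop-iterate xs (map (x ∷_) T) (≤-trans (≤-reflexive (length-map (x ∷_) T)) T≤M))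

  takeGains-iterate : ∀ gs cs xs → length gs ≤ M → Iterate M takeGains (length gs)
    (store i (encodeℕᵇ (fromℕ' (length gs))) nil (encodeSet (gs ++ cs)) (encodeSet xs) n c d b nil q)
    (store i nil nil (encodeSet cs) (encodeSet (gs ʳ++ xs)) n c d b nil q)
  takeGains-iterate []       cs xs gs≤M = stop refl
  takeGains-iterate (x ∷ gs) cs xs gs≤M = step (encode-suc≢nil (fromℕ' (length gs)))
    (decrement-exec (fromℕ' (length gs)) (≤-trans (digits-fromℕ (suc (length gs))) gs≤M) ⨾ assign ⨾ assign)
    (takeGains-iterate gs cs (x ∷ xs) (≤-trans (n≤1+n _) gs≤M))

  takeGains-exec : ∀ B → length (elements B) ≤ M → Exec M takeGains
    (store i (encodeℕ (capacity B)) nil (encodeSet (elements B)) nil n c d b nil q)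
    (store i nil nil (encodeSet (costElements B)) (encodeSet (gainElements B)) n c d b nil q)
  takeGains-exec {i = i} {n = n} {c = c} {d = d} {b = b} {q = q} B B≤M = subst₂
    (λ K xs → Exec M takeGains
      (store i K nil (encodeSet xs) nil n c d b nil q)
      (store i nil nil (encodeSet cs) (encodeSet (reverse gs)) n c d b nil q))
    (cong encodeℕᵇ (trans (cong fromℕ' lengths) (sym (fromℕ≡fromℕ' (capacity B)))))
    (take++drop≡id (capacity B) (elements B))
    (loop gs≤M (takeGains-iterate gs cs [] gs≤M))
    where
    gs = take (capacity B) (elements B)
    cs = drop (capacity B) (elements B)
    lengths : length gs ≡ capacity B
    lengths = trans (length-take (capacity B) (elements B)) (m≤n⇒m⊓n≡m (capacity≤elements B))
    gs≤M : length gs ≤ M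
    gs≤M = ≤-trans (≤-reflexive lengths) (≤-trans (capacity≤elements B) B≤M)

  processBlock-exec : ∀ B N {m} → Fits m N → length (elements B) + m ≤ M → Exec M processBlock
    (store ((encodeBlock B ∙ i) ∙ κ) nil nil nil nil (encodeTable N) nil nil nil nil nil)
    (store ((encodeBlock B ∙ i) ∙ κ) nil nil nil nil (encodeTable (addBlock B N)) nil nil nil nil nil)
  processBlock-exec {i = i} {κ = κ} B N {m} f B≤M =
    assign ⨾ assign ⨾ takeGains-exec B (≤-trans (m≤m+n _ m) B≤M) ⨾
    assign ⨾ loop (≤-trans (m≤m+n _ m) cs≤M)
      (costLoop-iterate cs N (≤-trans (proj₁ f) (≤-trans (m≤n+m m (length cs)) cs≤M))) ⨾
    assign ⨾ assign ⨾ loop (≤-trans (m≤m+n (length gs) _) gs+cs≤M)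
      (proj₂ (gainLoop-iterate gs N (addCosts cs N)
        (fits-mono (m≤n+m m (length cs)) f) (fits-addCosts cs f) gs+cs≤M)) ⨾
    assign
    where
    gs = gainElements B
    cs = costElements B
    gs+cs≤M : length gs + (length cs + m) ≤ M
    gs+cs≤M = ≤-trans (≤-reflexive (length-gains-costs B m)) B≤M
    cs≤M : length cs + m ≤ M
    cs≤M = ≤-trans (m≤n+m _ (length gs)) gs+cs≤M

  blockLoop-iterate : ∀ Bs N {m} → Fits m N → length (concatMap elements Bs) + m ≤ M →
    Iterate M blockLoop (length Bs)
      (store (encodeList encodeBlock Bs ∙ κ) nil nil nil nil (encodeTable N) nil nil nil nil nil)
      (store (nil ∙ κ) nil nil nil nil (encodeTable (addBlocks Bs N)) nil nil nil nil nil)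
  blockLoop-iterate []       N f _ = stop refl
  blockLoop-iterate (B ∷ Bs) N {m} f Bs≤M = step (λ ())
    (processBlock-exec B N f (≤-trans (m≤n+m _ (length (concatMap elements Bs))) bound) ⨾ assign)
    (blockLoop-iterate Bs (addBlock B N) (fits-addBlock B f) bound)
    where
    bound : length (concatMap elements Bs) + (length (elements B) + m) ≤ M
    bound = ≤-trans (≤-reflexive (length-ground-∷ B Bs m)) Bs≤M

  -- The count is bounded by the length of the table and not by `k`, which may be exponential in the
  -- size of its numeral.
  answerLoop-iterate : ∀ k N → digits (fromℕ' k) ≤ M →
    ∃[ s ] ∃[ τ ] s ≤ length N × lookup τ vI ≡ encodeAnswer (at N k) × Iterate M answerLoop s
      (store nil (encodeℕᵇ (fromℕ' k)) nil nil nil (encodeTable N) nil nil nil nil nil) τ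
  answerLoop-iterate k       []      _   = 0 , _ , z≤n , refl , stop refl
  answerLoop-iterate zero    (X ∷ N) _   = 1 , _ , s≤s z≤n , refl ,
    step (λ ()) (else refl (assign ⨾ assign)) (stop refl)
  answerLoop-iterate (suc k) (X ∷ N) k≤M
    with answerLoop-iterate k N (≤-trans (digits-suc (fromℕ' k)) k≤M)
  ... | s , τ , s≤ , eq , r = suc s , τ , s≤s s≤ , eq ,
    step (λ ()) (then (encode-suc≢nil (fromℕ' k)) (decrement-exec (fromℕ' k) k≤M ⨾ assign)) r

  -- The summand 1 is the number of entries of the start table.
  solver-exec : ∀ I → length (blocks (model I)) ≤ M → length (ground (model I)) + 1 ≤ M →
    digits (fromℕ (k I)) ≤ M →
    ∃[ τ ] lookup τ vI ≡ encodeAnswer (optimum I) ×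
      Exec M solver (store (encodeInstance I) nil nil nil nil nil nil nil nil nil nil) τ
  solver-exec I Bs≤M E≤M k≤M rewrite fromℕ≡fromℕ' (k I)
    with answerLoop-iterate (k I) (addBlocks (blocks (model I)) ([] ∷ [])) k≤M
  ... | s , τ , s≤ , eq , r = τ , eq ,
    (assign ⨾ loop Bs≤M (blockLoop-iterate (blocks (model I)) ([] ∷ []) (s≤s z≤n , z≤n ∷ []) E≤M) ⨾
     assign ⨾ assign ⨾
     loop (≤-trans s≤ (≤-trans (proj₁ (fits-addBlocks (blocks (model I)) (s≤s z≤n , z≤n ∷ []))) E≤M)) r)

-- Sizes of encodings

1≤size : ∀ t → 1 ≤ size t
1≤size nil     = s≤s z≤n
1≤size (_ ∙ _) = s≤s z≤n

digits≤size : ∀ m → digits m ≤ size (encodeℕᵇ m)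
digits≤size ℕᵇ.zero  = z≤n
digits≤size 1+[2 m ] = s≤s (m≤n⇒m≤1+n (digits≤size m))
digits≤size 2[1+ m ] = s≤s (m≤n⇒m≤o+n 3 (digits≤size m))

length<size : {A : Set} (encode : A → Tree) (xs : List A) → length xs < size (encodeList encode xs)
length<size encode []       = s≤s z≤n
length<size encode (x ∷ xs) = s≤s (m≤n⇒m≤o+n (size (encode x)) (length<size encode xs))

size-∈ : {A : Set} (encode : A → Tree) {x : A} {xs : List A} → x ∈ xs →
         size (encode x) ≤ size (encodeList encode xs)
size-∈ encode (here refl) = m≤n⇒m≤1+n (m≤m+n _ _)
size-∈ encode {xs = y ∷ _} (there x∈) = m≤n⇒m≤1+n (m≤n⇒m≤o+n (size (encode y)) (size-∈ encode x∈))

size-encodeList : {A : Set} (encode : A → Tree) (xs : List A) {m : ℕ} →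
  (∀ {x} → x ∈ xs → size (encode x) ≤ m) → size (encodeList encode xs) ≤ suc (length xs * suc m)
size-encodeList encode []       _     = ≤-refl
size-encodeList encode (x ∷ xs) {m} small = s≤s (begin
  size (encode x) + size (encodeList encode xs)  ≤⟨ +-mono-≤ (small (here refl)) (size-encodeList encode xs (small ∘ there)) ⟩
  m + suc (length xs * suc m)                    ≡⟨ +-suc m _ ⟩
  suc (length xs) * suc m                        ∎)
  where open ≤-Reasoning

length-support<size : ∀ Bs → length (support Bs) < size (encodeList encodeBlock Bs)
length-support<size []       = s≤s z≤n
length-support<size (B ∷ Bs) = s≤s (begin
  length (support (B ∷ Bs))                                ≡⟨ length-++ (elements B) ⟩
  length (elements B) + length (support Bs)                ≤⟨ +-mono-≤
    (≤-trans (<⇒≤ (length<size encodeℕ (elements B))) (m≤n⇒m≤1+n (m≤m+n _ _)))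
    (<⇒≤ (length-support<size Bs)) ⟩
  size (encodeBlock B) + size (encodeList encodeBlock Bs)  ∎)
  where open ≤-Reasoning

size-∈-support : ∀ Bs {x} → x ∈ support Bs → size (encodeℕ x) ≤ size (encodeList encodeBlock Bs)
size-∈-support (B ∷ Bs) x∈ with ∈-++⁻ (elements B) x∈
... | inj₁ x∈B  = m≤n⇒m≤1+n (≤-trans
  (≤-trans (size-∈ encodeℕ x∈B) (m≤n⇒m≤1+n (m≤m+n _ (size (encodeℕ (capacity B)))))) (m≤m+n _ _))
... | inj₂ x∈Bs = m≤n⇒m≤1+n (m≤n⇒m≤o+n (size (encodeBlock B)) (size-∈-support Bs x∈Bs))

size-blocks : ∀ I → size (encodeList encodeBlock (blocks (model I))) ≤ size (encodeInstance I)
size-blocks I = m≤n⇒m≤1+n (m≤m+n _ _)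

-- The answer consists of distinct ground elements, whose names all occur in the input: at most n
-- names of size at most n. The 3 pays for the `just` wrapper and the end of the list.
size-answer : ∀ I → let n = size (encodeInstance I) in
              size (encodeAnswer (optimum I)) ≤ 3 + n * (1 + n)
size-answer I with optimum I in eq
... | nothing = s≤s z≤n
... | just X with optimum-reducing I eq
...   | u , X⊆E , _ = s≤s (s≤s (≤-trans
  (size-encodeList encodeℕ X (λ x∈ → ≤-trans (size-∈-support Bs (X⊆E x∈)) (size-blocks I)))
  (s≤s (*-monoˡ-≤ (1 + size (encodeInstance I)) (begin
    length X                          ≤⟨ unique-⊆⇒length≤ u X⊆E ⟩
    length (support Bs)               ≤⟨ <⇒≤ (length-support<size Bs) ⟩
    size (encodeList encodeBlock Bs)  ≤⟨ size-blocks I ⟩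
    size (encodeInstance I)           ∎)))))
  where
  open ≤-Reasoning
  Bs = blocks (model I)

-- Assembly of the polynomial bound

polyTimeSolvable : {A B : Set} {encodeIn : A → Tree} {encodeOut : B → Tree} {Solution : A → B → Set} →
  (P : Program) (f : ℕ → ℕ) → PolynomiallyBounded f →
  ((a : A) → ∃[ b ] Solution a b × ∃[ t ] Computes P (encodeIn a) (encodeOut b) t ×
    t + size (encodeOut b) ≤ f (size (encodeIn a))) →
  PolyTimeSolvable encodeIn encodeOut Solution
polyTimeSolvable {encodeIn = encodeIn} P f (c , d , f≤) run = P , c , d , λ a →
  let b , correct , t , computes , t≤ = run a
  in b , correct , t , computes ,
     ≤-trans t≤ (≤-trans (f≤ (size (encodeIn a)) (1≤size (encodeIn a))) (m≤m+n _ c))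

solver-run : ∀ I → let n = size (encodeInstance I) in
  ∃[ t ] Computes (record { body = solver }) (encodeInstance I) (encodeAnswer (optimum I)) t ×
  t + size (encodeAnswer (optimum I)) ≤ timeBound n solver + (3 + n * (1 + n))
solver-run I
  with solver-exec {size (encodeInstance I)} I
         (≤-trans (<⇒≤ (length<size encodeBlock (blocks (model I)))) (size-blocks I))
         (≤-trans (≤-reflexive (+-comm _ 1))
           (≤-trans (length-support<size (blocks (model I))) (size-blocks I)))
         (≤-trans (digits≤size (fromℕ (k I)))
           (m≤n⇒m≤1+n (m≤n+m _ (size (encodeList encodeBlock (blocks (model I)))))))
... | τ , output , exec with exec⇒run exec
...   | t , r , t≤ = t , (τ , r , output) , +-mono-≤ t≤ (size-answer I)

theorem1 : PolyTimeSolvable encodeInstance encodeAnswer RankReductionSolution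
theorem1 = polyTimeSolvable (record { body = solver })
  (λ n → timeBound n solver + (3 + n * (1 + n)))
  (+-poly (timeBound-poly solver)
    (+-poly (const-poly 3) (*-poly id-poly (+-poly (const-poly 1) id-poly))))
  (λ I → optimum I , optimum-correct I , solver-run I)
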